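{- Fix an integer $k\ge 1$ and let $\alpha = 3/2+1/k$. There exists an offline algorithm $\mathrm{OFF}\in\mathcal{A}^k_\alpha$ such that for every request sequence $\sigma$ (with ring demands), $\mathrm{OFF}(\sigma)\le O(k)\cdot \mathrm{OPT}(\sigma)+O(n)$, i.e., there are absolute constants $C_1,C_2$ with $\mathrm{OFF}(\sigma)\le C_1 k\cdot\mathrm{OPT}(\sigma)+C_2 n$ for all $\sigma$.
   Context: Online bisection with ring demands: $n$ nodes $v_1,\dots,v_n$ ($n$ even) on a cycle with edges $(v_1,v_2),\dots,(v_n,v_1)$. An algorithm maintains a red/blue coloring of the nodes, starting from a fixed initial coloring with $n/2$ nodes of each color. Each request is a cycle edge; the algorithm pays $1$ if its endpoints have different colors (hit cost), then may recolor nodes at cost $1$ per node. $\mathrm{ALG}(\sigma)$ is the total cost on $\sigma$. A coloring is $\alpha$-balanced if each color is used on at most $\alpha n/2$ nodes; an algorithm is $\alpha$-augmented if after each request's recoloring its coloring is $\alpha$-balanced. $\mathrm{OPT}(\sigma)$ is the optimal offline cost among algorithms maintaining a $1$-balanced coloring. The cut-edges of a coloring are the cycle edges whose endpoints have different colors; any even-size set of cycle edges induces a coloring (up to swapping colors) having exactly those cut-edges. Global rebalancing: given a valid set $\mathcal{C}$ of cut-edges inducing a $1$-balanced coloring, a fixed deterministic procedure computes $\mathcal{C}_{2k}\subseteq\mathcal{C}$ with $|\mathcal{C}_{2k}|=\min\{2k,|\mathcal{C}|\}$ inducing a $(1+1/k)$-balanced coloring (e.g., while more than $2k$ cut-edges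 remain, recolor the smallest maximal monochromatic arc of the currently more frequent color). For $k\ge1$ and $\alpha\ge 1+1/k$, $\mathcal{A}^k_\alpha$ is the class of (online or offline) algorithms that (i) are $\alpha$-augmented, (ii) before processing the input replace the initial coloring by the coloring induced by applying the global rebalancing procedure to the cut-edges of the initial coloring, and (iii) at all times have at most $2k$ cut-edges. -}

module Defs where

open import Data.Nat using (ℕ; zero; suc; _+_; _*_; _≤_; _⊓_; NonZero)
open import Data.Nat.DivMod using (_mod_)
open import Data.Bool using (Bool; true; false; not; _xor_; if_then_else_)
open import Data.Fin using (Fin; toℕ) renaming (zero to fzero; suc to fsuc)
open import Data.List using (List; []; _∷_; length)
open import Data.Vec using (Vec; []; _∷_)
open import Data.Vec.Relation.Unary.All using (All)
open import Data.Product using (_×_)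
open import Relation.Binary.PropositionalEquality using (_≡_)

-- Nodes v_1..v_n are represented by Fin n (v_{i+1} ↦ i).
-- A coloring: true = red, false = blue.
Coloring : ℕ → Set
Coloring n = Fin n → Bool

count : ∀ {n} → (Fin n → Bool) → ℕ
count {zero}  f = 0
count {suc n} f = (if f fzero then 1 else 0) + count (λ i → f (fsuc i))

next : ∀ {n} .{{_ : NonZero n}} → Fin n → Fin n
next {n} i = suc (toℕ i) mod n

-- Cycle edges are indexed by Fin n: edge e joins node e and node (next e).
-- cutAt c e = true iff edge e is a cut-edge of c (endpoints colored differently).
cutAt : ∀ {n} .{{_ : NonZero n}} → Coloring n → Fin n → Bool
cutAt c e = c e xor c (next e)

cutCount : ∀ {n} .{{_ : NonZero n}} → Coloring n → ℕ
cutCount c = count (cutAt c)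

dist : ∀ {n} → Coloring n → Coloring n → ℕ
dist c d = count (λ v → c v xor d v)

-- (p/q)-balanced: each color used on at most (p/q)·n/2 nodes,
-- i.e. 2·q·(#color) ≤ p·n for both colors.
Balanced : ∀ {n} → ℕ → ℕ → Coloring n → Set
Balanced {n} p q c =
  (2 * q * count c ≤ p * n) × (2 * q * count (λ v → not (c v)) ≤ p * n)

hit : ∀ {n} .{{_ : NonZero n}} → Coloring n → Fin n → ℕ
hit c e = if cutAt c e then 1 else 0

-- Cost of serving σ starting from coloring c, where the i-th entry of the
-- schedule is the coloring after the recoloring following the i-th request:
-- hit cost (w.r.t. the current coloring) plus number of recolored nodes.
runCost : ∀ {n} .{{_ : NonZero n}} → Coloring n → (σ : List (Fin n)) →
          Vec (Coloring n) (length σ) → ℕ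
runCost c []      []       = 0
runCost c (e ∷ σ) (d ∷ ds) = hit c e + dist c d + runCost d σ ds

-- Specification of a global rebalancing procedure for parameter k
-- (acting on colorings; the output coloring is the one induced by C_{2k}):
-- for every 1-balanced coloring c, the cut-edges of R c form a subset of the
-- cut-edges of c of size min{2k, |C|}, and R c is (1+1/k)-balanced.
RebalancingProcedure : ∀ {n} .{{_ : NonZero n}} → ℕ → (Coloring n → Coloring n) → Set
RebalancingProcedure {n} k R =
  (c : Coloring n) → Balanced 1 1 c →
    ((e : Fin n) → cutAt (R c) e ≡ true → cutAt c e ≡ true)
    × (cutCount (R c) ≡ (2 * k) ⊓ cutCount c)
    × Balanced (k + 1) k (R c)

-- Membership in A^k_α with α = 3/2 + 1/k = (3k+2)/(2k) of an algorithm's run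
-- (given as the schedule of colorings after each request; its starting
-- coloring is R c0, fixed in the cost below): α-augmented and at most 2k
-- cut-edges at all times (the start R c0 has ≤ 2k cut-edges by the spec of R).
InClass : ∀ {n} .{{_ : NonZero n}} → (k : ℕ) → ∀ {m} → Vec (Coloring n) m → Set
InClass k ds = All (λ d → Balanced (3 * k + 2) (2 * k) d × cutCount d ≤ 2 * k) ds

offCost : ∀ {n} .{{_ : NonZero n}} → (Coloring n → Coloring n) → Coloring n →
          (σ : List (Fin n)) → Vec (Coloring n) (length σ) → ℕ
offCost R c0 σ ds = dist c0 (R c0) + runCost (R c0) σ ds

{-# OPTIONS --safe #-}
module Submission where

-- Two cuts suffice.  Write n = 2h and u = ⌊h / 2k⌋, fix an optimal offline schedule
-- and cut time into phases in which it pays at most u.  Restarting at a phase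
-- boundary costs O(n) = O(k u), which the optimum pays for.  Within a phase at most u
-- nodes are ever recoloured by the optimum, and among any h + u + 1 consecutive nodes
-- there are two never-recoloured nodes of opposite colours at distance at most u + 1,
-- because neither colour has more than h nodes.  Take one such pair anywhere and
-- another at distance between about n/4 and 3n/4 from it, and put one cut of the
-- simulating schedule between the nodes of each pair: this is balanced up to the u
-- slack.  The optimum always separates the two nodes of a pair, so a single cut
-- moving between them can serve the phase at the cost of the optimum plus u.
-- For this last claim let W(p) be the work function of the single cut, starting at
-- edge p.  It is 1-Lipschitz, and a request raises it in at most one point.  The sum
-- of ±W over the optimum's own cuts between the two nodes, with alternating signs,
-- is therefore at most the cost of the optimum, and it is at least W - u.

open import Defs
open import Algebra.Bundles using (CommutativeMonoid; CommutativeRing)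
import Algebra.Properties.CommutativeSemigroup as SemigroupProperties
open import Data.Bool using (Bool; true; false; not; _xor_; _∨_; if_then_else_; T)
open import Data.Bool.Properties using (xor-∧-commutativeRing; xor-identityʳ; xor-inverseˡ; xor-same)
open import Data.Nat
open import Data.Nat.Divisibility using (_∣_; divides)
open import Data.Nat.DivMod
open import Data.Nat.Properties
open import Data.Nat.Tactic.RingSolver using (solve-∀)
open import Data.Empty using (⊥-elim)
open import Data.Fin using (Fin; toℕ) renaming (zero to fzero; suc to fsuc)
open import Data.Fin.Properties using (toℕ-fromℕ<; toℕ-injective; toℕ<n)
open import Data.List using (List; []; _∷_; map; _++_; length; filter)
open import Data.List.Extrema.Nat using (argmin; argmin-all; f[argmin]≤v⁺)
open import Data.List.Membership.Propositional using (find; lose)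
open import Data.List.Membership.Propositional.Properties using (∈-filter⁺)
open import Data.List.Properties using (map-++; length-++)
open import Data.List.Relation.Unary.All using ([]; _∷_) renaming (All to ListAll)
import Data.List.Relation.Unary.All as ListAll
import Data.List.Relation.Unary.All.Properties as ListAll
open import Data.List.Relation.Unary.Any using (Any; here)
import Data.List.Relation.Unary.Any as Any
import Data.List.Relation.Unary.Any.Properties as Any
open import Data.Product using (Σ; _×_; _,_; proj₁; proj₂; ∃; ∃₂)
open import Data.Sum using (_⊎_; inj₁; inj₂)
open import Data.Vec using (Vec; []; _∷_)
import Data.Vec.Functional as Vector
open import Data.Vec.Relation.Unary.All using (All; []; _∷_)
open import Function using (_∘_)
open import Relation.Binary.PropositionalEquality
open import Relation.Nullary

private
  module XorProperties = SemigroupProperties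
    (CommutativeMonoid.commutativeSemigroup (CommutativeRing.+-commutativeMonoid xor-∧-commutativeRing))

open SemigroupProperties +-commutativeSemigroup using (x∙yz≈y∙xz)
  renaming (interchange to +-interchange)

-- Counting true values on `Fin n` and on initial segments of the naturals

bit : Bool → ℕ
bit b = if b then 1 else 0

bit≤1 : ∀ b → bit b ≤ 1
bit≤1 false = z≤n
bit≤1 true  = ≤-refl

bit-xor : ∀ a b → bit (a xor b) ≤ bit a + bit b
bit-xor false b     = ≤-refl
bit-xor true  false = ≤-refl
bit-xor true  true  = z≤n

bit-∨ : ∀ a b → bit (a ∨ b) ≤ bit a + bit b
bit-∨ false b = ≤-refl
bit-∨ true  b = s≤s z≤n

bit-≡ᵇ-refl : ∀ m → bit (m ≡ᵇ m) ≡ 1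
bit-≡ᵇ-refl zero    = refl
bit-≡ᵇ-refl (suc m) = bit-≡ᵇ-refl m

≡ᵇ-false : ∀ {m n} → m ≢ n → (m ≡ᵇ n) ≡ false
≡ᵇ-false {m} {n} m≢n with m ≡ᵇ n in eq
... | false = refl
... | true  = ⊥-elim (m≢n (≡ᵇ⇒≡ m n (subst T (sym eq) _)))

xor-interchange : ∀ a b c d → (a xor b) xor (c xor d) ≡ (a xor c) xor (b xor d)
xor-interchange = XorProperties.interchange

xor-cancelˡ : ∀ a b c → (a xor b) xor (a xor c) ≡ b xor c
xor-cancelˡ false b     c     = refl
xor-cancelˡ true  false false = refl
xor-cancelˡ true  false true  = refl
xor-cancelˡ true  true  false = refl
xor-cancelˡ true  true  true  = refl

cnt : (ℕ → Bool) → ℕ → ℕ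
cnt f zero    = 0
cnt f (suc m) = bit (f 0) + cnt (f ∘ suc) m

cnt-cong : ∀ {f g} m → (∀ i → i < m → f i ≡ g i) → cnt f m ≡ cnt g m
cnt-cong zero    f≡g = refl
cnt-cong (suc m) f≡g =
  cong₂ (λ b → bit b +_) (f≡g 0 z<s) (cnt-cong m (λ i i<m → f≡g (suc i) (s<s i<m)))

cnt-++ : ∀ f m k → cnt f (m + k) ≡ cnt f m + cnt (λ i → f (m + i)) k
cnt-++ f zero    k = refl
cnt-++ f (suc m) k =
  trans (cong (bit (f 0) +_) (cnt-++ (f ∘ suc) m k)) (sym (+-assoc (bit (f 0)) _ _))

cnt-snoc : ∀ f m → cnt f (suc m) ≡ cnt f m + bit (f m)
cnt-snoc f zero    = +-identityʳ _
cnt-snoc f (suc m) =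
  trans (cong (bit (f 0) +_) (cnt-snoc (f ∘ suc) m)) (sym (+-assoc (bit (f 0)) _ _))

cnt-monoʳ : ∀ f {m n} → m ≤ n → cnt f m ≤ cnt f n
cnt-monoʳ f {m} m≤n with m≤n⇒∃[o]m+o≡n m≤n
... | k , refl = ≤-trans (m≤m+n _ _) (≤-reflexive (sym (cnt-++ f m k)))

cnt-const-false : ∀ m → cnt (λ _ → false) m ≡ 0
cnt-const-false zero    = refl
cnt-const-false (suc m) = cnt-const-false m

cnt-shift : ∀ f n → f n ≡ f 0 → cnt (f ∘ suc) n ≡ cnt f n
cnt-shift f n fn≡f0 = +-cancelˡ-≡ (bit (f 0)) _ _ (trans (cnt-snoc f n)
  (trans (+-comm (cnt f n) _) (cong (λ b → bit b + cnt f n) fn≡f0)))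

cnt-rotate : ∀ f n → (∀ i → f (n + i) ≡ f i) → ∀ a → cnt (λ i → f (a + i)) n ≡ cnt f n
cnt-rotate f n per zero    = refl
cnt-rotate f n per (suc a) =
  trans (cnt-cong n (λ i _ → cong f (sym (+-suc a i))))
  (trans (cnt-shift (λ i → f (a + i)) n
           (trans (cong f (+-comm a n)) (trans (per a) (cong f (sym (+-identityʳ a))))))
         (cnt-rotate f n per a))

cnt-not : ∀ f m → cnt f m + cnt (not ∘ f) m ≡ m
cnt-not f zero    = refl
cnt-not f (suc m) = trans (+-interchange (bit (f 0)) _ _ _)
  (cong₂ _+_ (one (f 0)) (cnt-not (f ∘ suc) m))
  where
  one : ∀ b → bit b + bit (not b) ≡ 1
  one false = refl
  one true  = refl

cnt-≡ᵇ : ∀ p m → cnt (λ i → i ≡ᵇ p) m ≤ 1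
cnt-≡ᵇ p       zero    = z≤n
cnt-≡ᵇ zero    (suc m) = s≤s (≤-reflexive (cnt-const-false m))
cnt-≡ᵇ (suc p) (suc m) = cnt-≡ᵇ p m

count≡cnt : ∀ {m} (c : Fin m → Bool) f → (∀ i → c i ≡ f (toℕ i)) → count c ≡ cnt f m
count≡cnt {zero}  c f c≡f = refl
count≡cnt {suc m} c f c≡f =
  cong₂ (λ b → bit b +_) (c≡f fzero) (count≡cnt (c ∘ fsuc) (f ∘ suc) (c≡f ∘ fsuc))

count-≤ : ∀ {m} (c : Fin m → Bool) → count c ≤ m
count-≤ {zero}  c = z≤n
count-≤ {suc m} c = +-mono-≤ (bit≤1 (c fzero)) (count-≤ (c ∘ fsuc))

count-subadditive : ∀ {m} {f g h : Fin m → Bool} →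
                    (∀ i → bit (f i) ≤ bit (g i) + bit (h i)) → count f ≤ count g + count h
count-subadditive {zero}  f≤g+h = z≤n
count-subadditive {suc m} {f} {g} {h} f≤g+h = ≤-trans
  (+-mono-≤ (f≤g+h fzero) (count-subadditive (f≤g+h ∘ fsuc)))
  (≤-reflexive (+-interchange (bit (g fzero)) (bit (h fzero)) _ _))

count-cong : ∀ {m} {f g : Fin m → Bool} → (∀ i → f i ≡ g i) → count f ≡ count g
count-cong {zero}  f≡g = refl
count-cong {suc m} f≡g = cong₂ (λ b → bit b +_) (f≡g fzero) (count-cong (f≡g ∘ fsuc))

cnt-≮ᵇ : ∀ p n → p < n → cnt (λ i → not (p <ᵇ i)) n ≡ suc p
cnt-≮ᵇ zero    (suc n) _   = cong suc (cnt-const-false n)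
cnt-≮ᵇ (suc p) (suc n) p<n = cong suc (cnt-≮ᵇ p n (s<s⁻¹ p<n))

-- The threshold `p <ᵇ_` changes only across edge `p`, so two thresholds disagree exactly on the
-- nodes past the smaller and up to the larger; the bounds by `n` keep all of these inside the
-- count.
cnt-<ᵇ-xor : ∀ p r n → p < n → r < n → cnt (λ i → (p <ᵇ i) xor (r <ᵇ i)) n ≡ ∣ p - r ∣
cnt-<ᵇ-xor zero    zero    (suc n) _   _   = cnt-const-false n
cnt-<ᵇ-xor zero    (suc r) (suc n) _   r<n = cnt-≮ᵇ r n (s<s⁻¹ r<n)
cnt-<ᵇ-xor (suc p) zero    (suc n) p<n _   = trans
  (cnt-cong n (λ i _ → xor-true (p <ᵇ i))) (cnt-≮ᵇ p n (s<s⁻¹ p<n))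
  where
  xor-true : ∀ b → b xor true ≡ not b
  xor-true false = refl
  xor-true true  = refl
cnt-<ᵇ-xor (suc p) (suc r) (suc n) p<n r<n = cnt-<ᵇ-xor p r n (s<s⁻¹ p<n) (s<s⁻¹ r<n)

<ᵇ-step : ∀ p j → (p <ᵇ j) xor (p <ᵇ suc j) ≡ (j ≡ᵇ p)
<ᵇ-step zero    zero    = refl
<ᵇ-step zero    (suc j) = refl
<ᵇ-step (suc p) zero    = refl
<ᵇ-step (suc p) (suc j) = <ᵇ-step p j

<ᵇ-true : ∀ {p n} → p < n → (p <ᵇ n) ≡ true
<ᵇ-true {p} {n} p<n with p <ᵇ n | <⇒<ᵇ p<n
... | true | _ = refl

-- Coordinates on the ring

module _ {n : ℕ} .{{_ : NonZero n}} where

  toℕ-mod : ∀ m → toℕ (m mod n) ≡ m % n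
  toℕ-mod m = toℕ-fromℕ< (m%n<n m n)

  mod-cong : ∀ {m o} → m % n ≡ o % n → m mod n ≡ o mod n
  mod-cong {m} {o} eq = toℕ-injective (trans (toℕ-mod m) (trans eq (sym (toℕ-mod o))))

  toℕ-mod-id : ∀ (v : Fin n) → toℕ v mod n ≡ v
  toℕ-mod-id v = toℕ-injective (trans (toℕ-mod (toℕ v)) (m<n⇒m%n≡m (toℕ<n v)))

  mod-n+ : ∀ m → (n + m) mod n ≡ m mod n
  mod-n+ m = mod-cong (trans (cong (_% n) (+-comm n m)) ([m+n]%n≡m%n m n))

  [m%n+o]%n : ∀ m o → (m % n + o) % n ≡ (m + o) % n
  [m%n+o]%n m o = trans (%-distribˡ-+ (m % n) o n)
    (trans (cong (λ x → (x + o % n) % n) (m%n%n≡m%n m n)) (sym (%-distribˡ-+ m o n)))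

  [m+o%n]%n : ∀ m o → (m + o % n) % n ≡ (m + o) % n
  [m+o%n]%n m o = trans (cong (_% n) (+-comm m _)) (trans ([m%n+o]%n o m) (cong (_% n) (+-comm o m)))

  next-mod : ∀ m → next (m mod n) ≡ suc m mod n
  next-mod m = mod-cong (trans (cong (λ x → suc x % n) (toℕ-mod m)) ([m+o%n]%n 1 m))

  count-from : ∀ (c : Fin n → Bool) a → count c ≡ cnt (λ i → c ((a + i) mod n)) n
  count-from c a = trans (count≡cnt c (λ i → c (i mod n)) (λ v → cong c (sym (toℕ-mod-id v))))
    (sym (cnt-rotate (λ i → c (i mod n)) n (λ i → cong c (mod-n+ i)) a))

  -- The inverse of `i ↦ (a + i) mod n` on positions below `n`; `n ∸ a % n` serves as minus `a`
  -- modulo `n`.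
  coord : ℕ → Fin n → ℕ
  coord a v = (toℕ v + (n ∸ a % n)) % n

  coord<n : ∀ a v → coord a v < n
  coord<n a v = m%n<n _ n

  +-coord : ∀ a v → (a + coord a v) mod n ≡ v
  +-coord a v = toℕ-injective (trans (toℕ-mod (a + coord a v)) (begin
    (a + coord a v) % n                        ≡⟨ [m+o%n]%n a _ ⟩
    (a + (toℕ v + (n ∸ a % n))) % n            ≡⟨ [m%n+o]%n a _ ⟨
    (a % n + (toℕ v + (n ∸ a % n))) % n        ≡⟨ cong (_% n) (x∙yz≈y∙xz (a % n) (toℕ v) (n ∸ a % n)) ⟩
    (toℕ v + (a % n + (n ∸ a % n))) % n        ≡⟨ cong (λ x → (toℕ v + x) % n) (m+[n∸m]≡n (m%n≤n a n)) ⟩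
    (toℕ v + n) % n                            ≡⟨ [m+n]%n≡m%n (toℕ v) n ⟩
    toℕ v % n                                  ≡⟨ m<n⇒m%n≡m (toℕ<n v) ⟩
    toℕ v                                      ∎))
    where open ≡-Reasoning

  coord-+ : ∀ a {i} → i < n → coord a ((a + i) mod n) ≡ i
  coord-+ a {i} i<n = begin
    (toℕ ((a + i) mod n) + (n ∸ a % n)) % n    ≡⟨ cong (λ x → (x + (n ∸ a % n)) % n) (toℕ-mod (a + i)) ⟩
    ((a + i) % n + (n ∸ a % n)) % n            ≡⟨ [m%n+o]%n (a + i) _ ⟩
    (a + i + (n ∸ a % n)) % n                  ≡⟨ cong (_% n) (+-assoc a i _) ⟩
    (a + (i + (n ∸ a % n))) % n                ≡⟨ [m%n+o]%n a _ ⟨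
    (a % n + (i + (n ∸ a % n))) % n            ≡⟨ cong (_% n) (x∙yz≈y∙xz (a % n) i (n ∸ a % n)) ⟩
    (i + (a % n + (n ∸ a % n))) % n            ≡⟨ cong (λ x → (i + x) % n) (m+[n∸m]≡n (m%n≤n a n)) ⟩
    (i + n) % n                                ≡⟨ [m+n]%n≡m%n i n ⟩
    i % n                                      ≡⟨ m<n⇒m%n≡m i<n ⟩
    i                                          ∎
    where open ≡-Reasoning

  coord-unique : ∀ a {i e} → i < n → (a + i) mod n ≡ e → coord a e ≡ i
  coord-unique a i<n refl = coord-+ a i<n

-- A single cut in a window

-- Pairing each request with the colouring after it makes cutting and concatenating schedules plain
-- list operations, free of the length index in `runCost`.
Schedule : ℕ → Set
Schedule n = List (Fin n × Coloring n)

requests : ∀ {n} → Schedule n → List (Fin n)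
requests = map proj₁

cost : ∀ {n} .{{_ : NonZero n}} → Coloring n → Schedule n → ℕ
cost c []            = 0
cost c ((e , d) ∷ L) = hit c e + dist c d + cost d L

-- Follow pos m es p C: a single cut confined to the edges 0..m serves es from p at cost C.
data Follow {E : Set} (pos : E → ℕ) (m : ℕ) : List E → ℕ → ℕ → Set where
  stop : ∀ {p} → p ≤ m → Follow pos m [] p 0
  step : ∀ {e es p q C} → p ≤ m → Follow pos m es q C →
         Follow pos m (e ∷ es) p (bit (pos e ≡ᵇ p) + (∣ p - q ∣ + C))

-- χ falls at the cuts that count positively in the potential and rises at the others.
fall rise : Bool → Bool → ℕ → ℕ
fall true false w = w
fall _    _     w = 0
rise false true w = w
rise _     _    w = 0

-- The potential is `falls` minus `rises`. It can be negative, so the two sums are kept apart and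
-- placed on opposite sides of inequalities.
falls rises : (ℕ → ℕ) → (ℕ → Bool) → ℕ → ℕ
falls W χ zero    = 0
falls W χ (suc p) = falls W χ p + fall (χ p) (χ (suc p)) (W p)
rises W χ zero    = 0
rises W χ (suc p) = rises W χ p + rise (χ p) (χ (suc p)) (W p)

falls-zero : ∀ χ p → falls (λ _ → 0) χ p ≡ 0
falls-zero χ zero    = refl
falls-zero χ (suc p) = cong₂ _+_ (falls-zero χ p) (lemma (χ p) (χ (suc p)))
  where
  lemma : ∀ a b → fall a b 0 ≡ 0
  lemma true  false = refl
  lemma true  true  = refl
  lemma false b     = refl

rises-mono : ∀ {W W'} → (∀ p → W p ≤ W' p) → ∀ χ p → rises W χ p ≤ rises W' χ p
rises-mono W≤W' χ zero    = z≤n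
rises-mono W≤W' χ (suc p) = +-mono-≤ (rises-mono W≤W' χ p) (lemma (χ p) (χ (suc p)) (W≤W' p))
  where
  lemma : ∀ a b {w w'} → w ≤ w' → rise a b w ≤ rise a b w'
  lemma false true  w≤w' = w≤w'
  lemma false false w≤w' = z≤n
  lemma true  b     w≤w' = z≤n

raise : ℕ → (ℕ → ℕ) → ℕ → ℕ
raise j W p = bit (j ≡ᵇ p) + W p

falls-raise-below : ∀ W χ j {p} → p ≤ j → falls (raise j W) χ p ≡ falls W χ p
falls-raise-below W χ j {zero}  p≤j = refl
falls-raise-below W χ j {suc p} p<j = cong₂ _+_ (falls-raise-below W χ j (<⇒≤ p<j))
  (cong (λ b → fall (χ p) (χ (suc p)) (bit b + W p)) (≡ᵇ-false (>⇒≢ p<j)))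

-- Only the summand at edge `j` can grow, by one, and only if `χ` falls there; then `j` is a cut of
-- `χ` and its hit pays.
falls-raise : ∀ W χ j p → falls (raise j W) χ p ≤ falls W χ p + bit (χ j xor χ (suc j))
falls-raise W χ j zero    = z≤n
falls-raise W χ j (suc p) with j ≟ p
... | yes refl rewrite falls-raise-below W χ j {j} ≤-refl | bit-≡ᵇ-refl j =
  ≤-trans (+-monoʳ-≤ (falls W χ j) (lemma (χ j) (χ (suc j)) (W j)))
          (≤-reflexive (sym (+-assoc (falls W χ j) _ _)))
  where
  lemma : ∀ a b w → fall a b (suc w) ≤ fall a b w + bit (a xor b)
  lemma true  false w = ≤-reflexive (sym (+-comm w 1))
  lemma true  true  w = z≤n
  lemma false b     w = z≤n
... | no j≢p rewrite ≡ᵇ-false j≢p = begin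
  falls (raise j W) χ p + f                   ≤⟨ +-monoˡ-≤ f (falls-raise W χ j p) ⟩
  falls W χ p + bit (χ j xor χ (suc j)) + f   ≡⟨ lemma (falls W χ p) (bit (χ j xor χ (suc j))) f ⟩
  falls W χ p + f + bit (χ j xor χ (suc j))   ∎
  where
  open ≤-Reasoning
  f : ℕ
  f = fall (χ p) (χ (suc p)) (W p)
  lemma : ∀ x y z → x + y + z ≡ x + z + y
  lemma = solve-∀

Lipschitz : ℕ → (ℕ → ℕ) → Set
Lipschitz m W = ∀ p → p < m → W p ≤ suc (W (suc p)) × W (suc p) ≤ suc (W p)

-- Subtraction-free form of `fall - rise = (bit a - bit b) * w`: at a fixed weight, a cut is traded
-- for a change of the boundary colour.
fall-rise : ∀ a b w → fall a b w + bit b * w ≡ rise a b w + bit a * w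
fall-rise true  true  w = refl
fall-rise true  false w = refl
fall-rise false true  w = refl
fall-rise false false w = refl

-- Passing from `w` to `w'` changes both sides equally when `b` and `b'` agree; otherwise it changes
-- only one side, by at most one.
change-weight : ∀ b b' {Q Q' w w'} → w ≤ suc w' → w' ≤ suc w →
  Q + bit b * w ≤ Q' + bit b' * w → Q + bit b * w' ≤ Q' + bit b' * w' + bit (b xor b')
change-weight false false {Q} {Q'} _ _ le = ≤-trans le (≤-reflexive (sym (+-identityʳ _)))
change-weight true  true  {Q} {Q'} {w} {w'} _ _ le =
  ≤-trans (+-monoˡ-≤ (1 * w') (+-cancelʳ-≤ (1 * w) Q Q' le)) (≤-reflexive (sym (+-identityʳ _)))
change-weight true  false {Q} {Q'} {w} {w'} _ w'≤ le = begin
  Q + 1 * w'       ≤⟨ +-monoʳ-≤ Q (≤-reflexive (*-identityˡ w')) ⟩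
  Q + w'           ≤⟨ +-monoʳ-≤ Q w'≤ ⟩
  Q + suc w        ≡⟨ lemma Q w ⟩
  Q + 1 * w + 1    ≤⟨ +-monoˡ-≤ 1 le ⟩
  Q' + 0 + 1       ∎
  where
  open ≤-Reasoning
  lemma : ∀ x y → x + suc y ≡ x + 1 * y + 1
  lemma = solve-∀
change-weight false true  {Q} {Q'} {w} {w'} w≤ _ le = begin
  Q + 0            ≤⟨ le ⟩
  Q' + 1 * w       ≡⟨ cong (Q' +_) (*-identityˡ w) ⟩
  Q' + w           ≤⟨ +-monoʳ-≤ Q' w≤ ⟩
  Q' + suc w'      ≡⟨ lemma Q' w' ⟩
  Q' + 1 * w' + 1  ∎
  where
  open ≤-Reasoning
  lemma : ∀ x y → x + suc y ≡ x + 1 * y + 1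
  lemma = solve-∀

module _ {m : ℕ} {W : ℕ → ℕ} (lip : Lipschitz m W) {χ χ' : ℕ → Bool} (χ₀ : χ 0 ≡ χ' 0) where

  -- Abel summation turns the boundary weight into one difference of W per node.
  summation-by-parts : ∀ p → p ≤ m →
    falls W χ p + rises W χ' p + bit (χ p) * W p ≤
    falls W χ' p + rises W χ p + bit (χ' p) * W p + cnt (λ i → χ (suc i) xor χ' (suc i)) p
  summation-by-parts zero    _   =
    ≤-reflexive (trans (cong (λ b → bit b * W 0) χ₀) (sym (+-identityʳ _)))
  summation-by-parts (suc p) p<m = begin
    F + f + (R' + r') + bit (χ (suc p)) * W (suc p)
      -- The inner chain holds the weight at `W p`, where `fall-rise` carries the induction
      -- hypothesis to the boundary colours at `suc p`; replacing `W p` by `W (suc p)` then costs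
      -- `δ`.
      ≤⟨ change-weight (χ (suc p)) (χ' (suc p)) (proj₁ (lip p p<m)) (proj₂ (lip p p<m)) (begin
        F + f + (R' + r') + bit (χ (suc p)) * W p
          ≡⟨ move₁ F f R' r' _ ⟩
        F + R' + (f + bit (χ (suc p)) * W p) + r'
          ≡⟨ cong (λ x → F + R' + x + r') (fall-rise (χ p) (χ (suc p)) (W p)) ⟩
        F + R' + (r + bit (χ p) * W p) + r'
          ≡⟨ move₂ F R' r (bit (χ p) * W p) r' ⟩
        F + R' + bit (χ p) * W p + (r + r')
          ≤⟨ +-monoˡ-≤ (r + r') (summation-by-parts p (<⇒≤ p<m)) ⟩
        F' + R + bit (χ' p) * W p + c + (r + r')
          ≡⟨ move₃ F' R (bit (χ' p) * W p) c r r' ⟩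
        F' + (R + r) + c + (r' + bit (χ' p) * W p)
          ≡⟨ cong (F' + (R + r) + c +_) (fall-rise (χ' p) (χ' (suc p)) (W p)) ⟨
        F' + (R + r) + c + (f' + bit (χ' (suc p)) * W p)
          ≡⟨ move₄ F' R r c f' _ ⟩
        F' + f' + (R + r) + c + bit (χ' (suc p)) * W p ∎) ⟩
    F' + f' + (R + r) + c + bit (χ' (suc p)) * W (suc p) + δ
      ≡⟨ move₅ (F' + f' + (R + r)) c _ δ ⟩
    F' + f' + (R + r) + bit (χ' (suc p)) * W (suc p) + (c + δ)
      ≡⟨ cong (F' + f' + (R + r) + bit (χ' (suc p)) * W (suc p) +_) (cnt-snoc _ p) ⟨
    F' + f' + (R + r) + bit (χ' (suc p)) * W (suc p) + cnt (λ i → χ (suc i) xor χ' (suc i)) (suc p) ∎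
    where
    open ≤-Reasoning
    F F' R R' f f' r r' c δ : ℕ
    F  = falls W χ p
    F' = falls W χ' p
    R  = rises W χ p
    R' = rises W χ' p
    f  = fall (χ p) (χ (suc p)) (W p)
    f' = fall (χ' p) (χ' (suc p)) (W p)
    r  = rise (χ p) (χ (suc p)) (W p)
    r' = rise (χ' p) (χ' (suc p)) (W p)
    c  = cnt (λ i → χ (suc i) xor χ' (suc i)) p
    δ  = bit (χ (suc p) xor χ' (suc p))
    move₁ : ∀ F f R r b → F + f + (R + r) + b ≡ F + R + (f + b) + r
    move₁ = solve-∀
    move₂ : ∀ F R s b r → F + R + (s + b) + r ≡ F + R + b + (s + r)
    move₂ = solve-∀
    move₃ : ∀ F R b c s r → F + R + b + c + (s + r) ≡ F + (R + s) + c + (r + b)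
    move₃ = solve-∀
    move₄ : ∀ F R s c f b → F + (R + s) + c + (f + b) ≡ F + f + (R + s) + c + b
    move₄ = solve-∀
    move₅ : ∀ X c b d → X + c + b + d ≡ X + b + (c + d)
    move₅ = solve-∀

-- `falls` minus `rises` plus the boundary term starts at `W 0`, since `χ 0` is true. Crossing an
-- edge at fixed weight preserves it by `fall-rise`, and shifting the weight to the next edge loses
-- at most one; this is the additive `p`.
weight-at-0 : ∀ {m W} → Lipschitz m W → ∀ χ → χ 0 ≡ true → ∀ p → p ≤ m →
  W 0 + rises W χ p ≤ falls W χ p + bit (χ p) * W p + p
weight-at-0 {W = W} lip χ χ₀ zero    _   rewrite χ₀ = ≤-reflexive (lemma (W 0))
  where
  lemma : ∀ x → x + 0 ≡ 1 * x + 0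
  lemma = solve-∀
weight-at-0 {W = W} lip χ χ₀ (suc p) p<m = begin
  W 0 + (R + r)                                      ≡⟨ +-assoc (W 0) R r ⟨
  W 0 + R + r                                        ≤⟨ +-monoˡ-≤ r (weight-at-0 lip χ χ₀ p (<⇒≤ p<m)) ⟩
  F + bit (χ p) * W p + p + r                        ≡⟨ move₁ F (bit (χ p) * W p) p r ⟩
  F + (r + bit (χ p) * W p) + p                      ≡⟨ cong (λ x → F + x + p) (fall-rise (χ p) (χ (suc p)) (W p)) ⟨
  F + (f + bit (χ (suc p)) * W p) + p                ≤⟨ +-monoˡ-≤ p (+-monoʳ-≤ F (+-monoʳ-≤ f (lemma (χ (suc p)) (proj₁ (lip p p<m))))) ⟩
  F + (f + (bit (χ (suc p)) * W (suc p) + 1)) + p    ≡⟨ move₂ F f _ p ⟩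
  F + f + bit (χ (suc p)) * W (suc p) + suc p        ∎
  where
  open ≤-Reasoning
  F R f r : ℕ
  F = falls W χ p
  R = rises W χ p
  f = fall (χ p) (χ (suc p)) (W p)
  r = rise (χ p) (χ (suc p)) (W p)
  lemma : ∀ b {w w'} → w ≤ suc w' → bit b * w ≤ bit b * w' + 1
  lemma false w≤ = z≤n
  lemma true {w} {w'} w≤ rewrite *-identityˡ w | *-identityˡ w' | +-comm w' 1 = w≤
  move₁ : ∀ F b p r → F + b + p + r ≡ F + (r + b) + p
  move₁ = solve-∀
  move₂ : ∀ F f b p → F + (f + (b + 1)) + p ≡ F + f + b + suc p
  move₂ = solve-∀

-- A request at j raises the work function at j unless the cut can dodge to a
-- neighbour that is cheaper by one.
LocalMin : ℕ → (ℕ → ℕ) → ℕ → Set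
LocalMin m W j = (∀ i → suc i ≡ j → W j ≤ W i) × (j < m → W j ≤ W (suc j))

LowerNeighbour : ℕ → (ℕ → ℕ) → ℕ → Set
LowerNeighbour m W j = ∃ λ r → r ≤ m × ∣ j - r ∣ ≡ 1 × W r < W j

localMin? : ∀ m W j → j ≤ m → LocalMin m W j ⊎ LowerNeighbour m W j
localMin? m W j j≤m with left j j≤m | right
  where
  left : ∀ j → j ≤ m → (∀ i → suc i ≡ j → W j ≤ W i) ⊎ LowerNeighbour m W j
  left zero    _ = inj₁ λ _ ()
  left (suc i) i<m with W (suc i) ≤? W i
  ... | yes le = inj₁ λ { _ refl → le }
  ... | no  gt = inj₂ (i , <⇒≤ i<m , trans (∣-∣-comm (suc i) i) (∣n-1+n∣ i) , ≰⇒> gt)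
    where
    ∣n-1+n∣ : ∀ n → ∣ n - suc n ∣ ≡ 1
    ∣n-1+n∣ zero    = refl
    ∣n-1+n∣ (suc n) = ∣n-1+n∣ n
  right : (j < m → W j ≤ W (suc j)) ⊎ LowerNeighbour m W j
  right with j <? m | W j ≤? W (suc j)
  ... | no j≮m  | _      = inj₁ λ j<m → ⊥-elim (j≮m j<m)
  ... | yes _   | yes le = inj₁ λ _ → le
  ... | yes j<m | no gt  = inj₂ (suc j , j<m , trans (cong (∣ j -_∣) (+-comm 1 j)) (∣m-m+n∣≡n j 1) , ≰⇒> gt)
... | inj₂ low | _        = inj₂ low
... | inj₁ _   | inj₂ low = inj₂ low
... | inj₁ l   | inj₁ r   = inj₁ (l , r)

raise-≥ : ∀ j W p → W p ≤ raise j W p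
raise-≥ j W p = m≤n+m (W p) _

raise-≤ : ∀ j W p → raise j W p ≤ suc (W p)
raise-≤ j W p = +-monoˡ-≤ (W p) (bit≤1 (j ≡ᵇ p))

raise-≢ : ∀ {j p} W → j ≢ p → raise j W p ≡ W p
raise-≢ {p = p} W j≢p = cong (λ b → bit b + W p) (≡ᵇ-false j≢p)

-- Raising `W j` by one could break the condition only where a neighbour is already lower, which
-- local minimality excludes.
raise-Lipschitz : ∀ {m W j} → Lipschitz m W → LocalMin m W j → Lipschitz m (raise j W)
raise-Lipschitz {m} {W} {j} lip (minˡ , minʳ) p p<m = l , r
  where
  l : raise j W p ≤ suc (raise j W (suc p))
  l with j ≟ p
  ... | yes refl = ≤-trans (raise-≤ j W j) (s≤s (≤-trans (minʳ p<m) (raise-≥ j W (suc j))))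
  ... | no  j≢p  = ≤-trans (≤-reflexive (raise-≢ W j≢p))
                     (≤-trans (proj₁ (lip p p<m)) (s≤s (raise-≥ j W (suc p))))
  r : raise j W (suc p) ≤ suc (raise j W p)
  r with j ≟ suc p
  ... | yes refl = ≤-trans (raise-≤ j W j) (s≤s (≤-trans (minˡ p refl) (raise-≥ j W p)))
  ... | no  j≢p  = ≤-trans (≤-reflexive (raise-≢ W j≢p))
                     (≤-trans (proj₂ (lip p p<m)) (s≤s (raise-≥ j W p)))

-- Edge `i` of the window joins nodes `i` and `suc i`, so the cut ranges over edges `0..m` and the
-- anchors are nodes `0` and `suc m`. The anchors keep their colours, so `dist≥` counts just the
-- inner nodes `1..m`.
module Window {n : ℕ} .{{_ : NonZero n}} (color : Coloring n → ℕ → Bool) (pos : Fin n → ℕ) (m : ℕ)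
  (hit≥ : ∀ c e → pos e ≤ m → bit (color c (pos e) xor color c (suc (pos e))) ≤ hit c e)
  (dist≥ : ∀ c d → cnt (λ i → color c (suc i) xor color d (suc i)) m ≤ dist c d)
  where

  Anchored : Coloring n → Set
  Anchored c = color c 0 ≡ true × color c (suc m) ≡ false

  Φ≤ : (ℕ → ℕ) → Coloring n → ℕ → Set
  Φ≤ W c C = falls W (color c) (suc m) ≤ rises W (color c) (suc m) + C

  -- `W p` is a cost to go. The free choice of `q` in `reach` permits a move before the first
  -- request, and `potential` bounds the alternating sum of `W` over the cuts of any anchored
  -- schedule by that schedule's cost.
  record WorkFunction (L : Schedule n) : Set where
    field
      W         : ℕ → ℕ
      lipschitz : Lipschitz m W
      reach     : ∀ p → p ≤ m → ∃₂ λ q C → Follow pos m (requests L) q C × ∣ p - q ∣ + C ≤ W p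
      potential : ∀ c → Anchored c → ListAll (Anchored ∘ proj₂) L → Φ≤ W c (cost c L)

  -- The last anchor is false, so edge `m` never carries a rise, and it carries a fall exactly when
  -- node `m` is true. With `falls-last` this brings the sums into the form of `summation-by-parts`.
  rises-last : ∀ W c → Anchored c → rises W (color c) (suc m) ≡ rises W (color c) m
  rises-last W c (_ , end) rewrite end = trans (cong (rises W (color c) m +_) (lemma (color c m))) (+-identityʳ _)
    where
    lemma : ∀ b → rise b false (W m) ≡ 0
    lemma false = refl
    lemma true  = refl

  falls-last : ∀ W c → Anchored c →
    falls W (color c) (suc m) ≡ falls W (color c) m + bit (color c m) * W m
  falls-last W c (_ , end) rewrite end = cong (falls W (color c) m +_) (lemma (color c m))
    where
    lemma : ∀ b → fall b false (W m) ≡ bit b * W m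
    lemma false = refl
    lemma true  = sym (+-identityʳ _)

  -- Recolouring one inner node moves a cut to the adjacent edge, or creates or removes two adjacent
  -- cuts of opposite sign. Either way the potential changes by at most one; `summation-by-parts`
  -- treats all nodes at once.
  recolor : ∀ {W} → Lipschitz m W → ∀ {c d C} → Anchored c → Anchored d →
            Φ≤ W d C → Φ≤ W c (dist c d + C)
  recolor {W} lip {c} {d} {C} ac ad Φd = +-cancelʳ-≤ Rd Fc (Rc + (dist c d + C)) (begin
    Fc + Rd                       ≡⟨ cong₂ _+_ (falls-last W c ac) (rises-last W d ad) ⟩
    fc + bc + rd                  ≡⟨ move₁ fc bc rd ⟩
    fc + rd + bc                  ≤⟨ summation-by-parts lip (trans (proj₁ ac) (sym (proj₁ ad))) m ≤-refl ⟩
    fd + rc + bd + δ              ≤⟨ +-monoʳ-≤ (fd + rc + bd) (dist≥ c d) ⟩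
    fd + rc + bd + dist c d       ≡⟨ move₂ fd rc bd (dist c d) ⟩
    fd + bd + rc + dist c d       ≡⟨ cong₂ (λ x y → x + y + dist c d) (falls-last W d ad) (rises-last W c ac) ⟨
    Fd + Rc + dist c d            ≤⟨ +-monoˡ-≤ (dist c d) (+-monoˡ-≤ Rc Φd) ⟩
    Rd + C + Rc + dist c d        ≡⟨ move₃ Rd C Rc (dist c d) ⟩
    Rc + (dist c d + C) + Rd      ∎)
    where
    open ≤-Reasoning
    Fc Fd Rc Rd fc fd rc rd bc bd δ : ℕ
    Fc = falls W (color c) (suc m)
    Fd = falls W (color d) (suc m)
    Rc = rises W (color c) (suc m)
    Rd = rises W (color d) (suc m)
    fc = falls W (color c) m
    fd = falls W (color d) m
    rc = rises W (color c) m
    rd = rises W (color d) m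
    bc = bit (color c m) * W m
    bd = bit (color d m) * W m
    δ  = cnt (λ i → color c (suc i) xor color d (suc i)) m
    move₁ : ∀ f b r → f + b + r ≡ f + r + b
    move₁ = solve-∀
    move₂ : ∀ f r b d → f + r + b + d ≡ f + b + r + d
    move₂ = solve-∀
    move₃ : ∀ R C R' d → R + C + R' + d ≡ R' + (d + C) + R
    move₃ = solve-∀

  -- Built backwards from the last request. `W` stays the same if the request lies outside the
  -- window or at an edge with a cheaper neighbour. Otherwise it is raised at that edge, and a
  -- schedule whose potential grows there pays for it with a hit.
  workFunction : ∀ L → WorkFunction L
  workFunction [] = record
    { W         = λ _ → 0
    ; lipschitz = λ _ _ → z≤n , z≤n
    ; reach     = λ p p≤m → p , 0 , stop p≤m , ≤-reflexive (trans (+-identityʳ _) (∣n-n∣≡0 p))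
    ; potential = λ c _ _ → ≤-trans (≤-reflexive (falls-zero (color c) (suc m))) z≤n
    }
  workFunction ((e , d) ∷ L) = extend (pos e ≤? m)
    where
    open WorkFunction (workFunction L)

    idle : ∀ p → p ≤ m → ∃₂ λ q C →
           Follow pos m (e ∷ requests L) q C × ∣ p - q ∣ + C ≤ bit (pos e ≡ᵇ p) + W p
    idle p p≤m with reach p p≤m
    ... | q , C , fol , le = p , _ , step p≤m fol , (begin
      ∣ p - p ∣ + (bit (pos e ≡ᵇ p) + (∣ p - q ∣ + C))  ≡⟨ cong (_+ (bit (pos e ≡ᵇ p) + (∣ p - q ∣ + C))) (∣n-n∣≡0 p) ⟩
      bit (pos e ≡ᵇ p) + (∣ p - q ∣ + C)                ≤⟨ +-monoʳ-≤ (bit (pos e ≡ᵇ p)) le ⟩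
      bit (pos e ≡ᵇ p) + W p                            ∎)
      where open ≤-Reasoning

    miss : ∀ p → pos e ≢ p → p ≤ m → ∃₂ λ q C →
           Follow pos m (e ∷ requests L) q C × ∣ p - q ∣ + C ≤ W p
    miss p e≢p p≤m with q , C , fol , le ← idle p p≤m = q , C , fol ,
      ≤-trans le (≤-reflexive (raise-≢ W e≢p))

    unraised : ∀ c → Anchored c → ListAll (Anchored ∘ proj₂) ((e , d) ∷ L) →
               Φ≤ W c (cost c ((e , d) ∷ L))
    unraised c ac (ad ∷ aL) = ≤-trans (recolor lipschitz {c} {d} ac ad (potential d ad aL))
      (+-monoʳ-≤ (rises W (color c) (suc m)) (+-monoˡ-≤ (cost d L) (m≤n+m (dist c d) (hit c e))))

    extend : Dec (pos e ≤ m) → WorkFunction ((e , d) ∷ L)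
    extend (no pos≰m) = record
      { W         = W
      ; lipschitz = lipschitz
      ; reach     = λ p p≤m → miss p (λ eq → pos≰m (≤-trans (≤-reflexive eq) p≤m)) p≤m
      ; potential = unraised
      }
    extend (yes pos≤m) with localMin? m W (pos e) pos≤m
    ... | inj₁ locMin = record
      { W         = raise (pos e) W
      ; lipschitz = raise-Lipschitz lipschitz locMin
      ; reach     = idle
      ; potential = λ { c ac (ad ∷ aL) → begin
          falls (raise (pos e) W) (color c) (suc m)
            ≤⟨ falls-raise W (color c) (pos e) (suc m) ⟩
          falls W (color c) (suc m) + bit (color c (pos e) xor color c (suc (pos e)))
            ≤⟨ +-mono-≤ (recolor lipschitz {c} {d} ac ad (potential d ad aL)) (hit≥ c e pos≤m) ⟩
          rises W (color c) (suc m) + (dist c d + cost d L) + hit c e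
            ≡⟨ move (rises W (color c) (suc m)) (dist c d) (cost d L) (hit c e) ⟩
          rises W (color c) (suc m) + (hit c e + dist c d + cost d L)
            -- If the raised edge is a rise of `c`, the potential only falls.
            ≤⟨ +-monoˡ-≤ _ (rises-mono (raise-≥ (pos e) W) (color c) (suc m)) ⟩
          rises (raise (pos e) W) (color c) (suc m) + (hit c e + dist c d + cost d L) ∎ }
      }
      where
      open ≤-Reasoning
      move : ∀ R d C h → R + (d + C) + h ≡ R + (h + d + C)
      move = solve-∀
    ... | inj₂ (r , r≤m , ∣e-r∣≡1 , Wr<We) = record
      { W         = W
      ; lipschitz = lipschitz
      ; reach     = dodge
      ; potential = unraised
      }
      where
      -- A cut standing at `pos e` moves to `r` first and escapes the hit; `W r < W p` covers the
      -- unit cost of the move.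
      dodge : ∀ p → p ≤ m → ∃₂ λ q C →
              Follow pos m (e ∷ requests L) q C × ∣ p - q ∣ + C ≤ W p
      dodge p p≤m with pos e ≟ p
      ... | no e≢p   = miss p e≢p p≤m
      ... | yes refl with reach r r≤m
      ...   | q , C , fol , le = r , _ , step r≤m fol , (begin
        ∣ p - r ∣ + (bit (p ≡ᵇ r) + (∣ r - q ∣ + C))
          ≡⟨ cong₂ (λ x b → x + (bit b + (∣ r - q ∣ + C))) ∣e-r∣≡1 (≡ᵇ-false p≢r) ⟩
        suc (∣ r - q ∣ + C)   ≤⟨ s≤s le ⟩
        suc (W r)             ≤⟨ Wr<We ⟩
        W p                   ∎)
        where
        open ≤-Reasoning
        p≢r : p ≢ r
        p≢r refl with () ← trans (sym (∣n-n∣≡0 p)) ∣e-r∣≡1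

  -- `W 0` bounds a run from some edge; `weight-at-0` compares it with the potential of `c` up to
  -- `m`, and `potential` compares that with the cost. The starting edge may be arbitrary, because
  -- each phase begins with a restart.
  follow : ∀ c L → Anchored c → ListAll (Anchored ∘ proj₂) L →
           ∃₂ λ p C → Follow pos m (requests L) p C × C ≤ cost c L + m
  follow c L ac aL with reach 0 z≤n
    where open WorkFunction (workFunction L)
  ... | p , C , fol , le = p , C , fol , +-cancelʳ-≤ R C (cost c L + m) (begin
    C + R                                   ≤⟨ +-monoˡ-≤ R (≤-trans (m≤n+m C _) le) ⟩
    W 0 + R                                 ≤⟨ weight-at-0 lipschitz (color c) (proj₁ ac) m ≤-refl ⟩
    falls W (color c) m + bit (color c m) * W m + m
                                            ≡⟨ cong (_+ m) (falls-last W c ac) ⟨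
    falls W (color c) (suc m) + m           ≤⟨ +-monoˡ-≤ m (potential c ac aL) ⟩
    rises W (color c) (suc m) + cost c L + m ≡⟨ cong (λ x → x + cost c L + m) (rises-last W c ac) ⟩
    R + cost c L + m                        ≡⟨ move R (cost c L) m ⟩
    cost c L + m + R                        ∎)
    where
    open ≤-Reasoning
    open WorkFunction (workFunction L)
    R : ℕ
    R = rises W (color c) m
    move : ∀ R C m → R + C + m ≡ C + m + R
    move = solve-∀

-- Colourings with two cuts

module _ {n : ℕ} .{{_ : NonZero n}} where

  next-coord : ∀ a e → next e ≡ (a + suc (coord a e)) mod n
  next-coord a e = trans (cong next (sym (+-coord a e)))
    (trans (next-mod (a + coord a e)) (cong (_mod n) (sym (+-suc a (coord a e)))))

  count-coord : ∀ a f → count {n} (f ∘ coord a) ≡ cnt f n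
  count-coord a f = trans (count-from (f ∘ coord a) a)
    (cnt-cong n (λ i i<n → cong f (coord-+ a i<n)))

  -- In coordinates from a, the nodes between the cuts at edges p and r.
  arc : ℕ → ℕ → ℕ → Coloring n
  arc a p r v = (p <ᵇ coord a v) xor (r <ᵇ coord a v)

  count-arc : ∀ a {p r} → p < n → r < n → count (arc a p r) ≡ ∣ p - r ∣
  count-arc a {p} {r} p<n r<n =
    trans (count-coord a (λ i → (p <ᵇ i) xor (r <ᵇ i))) (cnt-<ᵇ-xor p r n p<n r<n)

  -- Regrouping the xor, the difference of the two colourings is the xor of the arcs swept by the
  -- two moving cuts.
  dist-arc : ∀ a {p p' r r'} → p < n → p' < n → r < n → r' < n →
             dist (arc a p r) (arc a p' r') ≤ ∣ p - p' ∣ + ∣ r - r' ∣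
  dist-arc a {p} {p'} {r} {r'} p<n p'<n r<n r'<n = ≤-trans
    (count-subadditive {f = λ v → arc a p r v xor arc a p' r' v} {arc a p p'} {arc a r r'}
      (λ v → ≤-trans (≤-reflexive (cong bit
                (xor-interchange (p <ᵇ coord a v) (r <ᵇ coord a v) (p' <ᵇ coord a v) (r' <ᵇ coord a v))))
              (bit-xor (arc a p p' v) (arc a r r' v))))
    (≤-reflexive (cong₂ _+_ (count-arc a p<n p'<n) (count-arc a r<n r'<n)))

  -- At the last edge the formula reads coordinate `n` although the next node has coordinate `0`.
  -- Both thresholds are true at `n` and both are false at `0`, so the xor agrees and closing the
  -- ring creates no further cut.
  arc-next : ∀ a {p r} → p < n → r < n → ∀ e →
             arc a p r (next e) ≡ (p <ᵇ suc (coord a e)) xor (r <ᵇ suc (coord a e))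
  arc-next a {p} {r} p<n r<n e with m≤n⇒m<n∨m≡n (coord<n a e)
  ... | inj₁ j+1<n = cong (λ i → (p <ᵇ i) xor (r <ᵇ i))
    (trans (cong (coord a) (next-coord a e)) (coord-+ a j+1<n))
  ... | inj₂ j+1≡n = trans
    (cong (λ i → (p <ᵇ i) xor (r <ᵇ i)) (trans (cong (coord a) (trans (next-coord a e) wrap))
      (coord-+ a (>-nonZero⁻¹ n))))
    (sym (cong₂ _xor_ (above p<n) (above r<n)))
    where
    above : ∀ {p} → p < n → (p <ᵇ suc (coord a e)) ≡ true
    above p<n = <ᵇ-true (≤-trans p<n (≤-reflexive (sym j+1≡n)))
    wrap : (a + suc (coord a e)) mod n ≡ (a + 0) mod n
    wrap = trans (cong (λ x → (a + x) mod n) j+1≡n)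
      (trans (cong (_mod n) (+-comm a n)) (trans (mod-n+ a) (cong (_mod n) (sym (+-identityʳ a)))))

  hit-arc : ∀ a {p r} → p < n → r < n → ∀ e →
            hit (arc a p r) e ≤ bit (coord a e ≡ᵇ p) + bit (coord a e ≡ᵇ r)
  hit-arc a {p} {r} p<n r<n e = begin
    bit (arc a p r e xor arc a p r (next e))
      ≡⟨ cong (λ b → bit (arc a p r e xor b)) (arc-next a p<n r<n e) ⟩
    bit (((p <ᵇ j) xor (r <ᵇ j)) xor ((p <ᵇ suc j) xor (r <ᵇ suc j)))
      ≡⟨ cong bit (xor-interchange (p <ᵇ j) (r <ᵇ j) (p <ᵇ suc j) (r <ᵇ suc j)) ⟩
    bit (((p <ᵇ j) xor (p <ᵇ suc j)) xor ((r <ᵇ j) xor (r <ᵇ suc j)))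
      ≡⟨ cong₂ (λ x y → bit (x xor y)) (<ᵇ-step p j) (<ᵇ-step r j) ⟩
    bit ((j ≡ᵇ p) xor (j ≡ᵇ r))
      ≤⟨ bit-xor (j ≡ᵇ p) (j ≡ᵇ r) ⟩
    bit (j ≡ᵇ p) + bit (j ≡ᵇ r) ∎
    where
    open ≤-Reasoning
    j : ℕ
    j = coord a e

  cutCount-arc : ∀ a {p r} → p < n → r < n → cutCount (arc a p r) ≤ 2
  cutCount-arc a {p} {r} p<n r<n = ≤-trans
    (count-subadditive {f = cutAt (arc a p r)} {λ e → coord a e ≡ᵇ p} {λ e → coord a e ≡ᵇ r}
      (hit-arc a p<n r<n))
    (+-mono-≤ (single p) (single r))
    where
    single : ∀ p → count {n} (λ e → coord a e ≡ᵇ p) ≤ 1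
    single p = ≤-trans (≤-reflexive (count-coord a (_≡ᵇ p))) (cnt-≡ᵇ p n)

  module _ (a g : ℕ) {m₁ m₂ : ℕ} (m₁<n : m₁ < n) (g+m₂<n : g + m₂ < n) where

    request-shift : ∀ e {q} → q ≤ m₂ → bit (coord a e ≡ᵇ g + q) ≤ bit (coord (a + g) e ≡ᵇ q)
    request-shift e {q} q≤m₂ with coord a e ≟ g + q
    ... | no  ne rewrite ≡ᵇ-false ne = z≤n
    ... | yes eq rewrite coord-unique (a + g) {q} {e} (≤-<-trans (≤-trans q≤m₂ (m≤n+m m₂ g)) g+m₂<n)
            (trans (cong (_mod n) (trans (+-assoc a g q) (cong (a +_) (sym eq)))) (+-coord a e))
      | bit-≡ᵇ-refl q = bit≤1 _

    -- The two cuts serve the same requests independently, and their hits and moves add up. `P` will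
    -- be membership in the class; it holds for every placement of the cuts in their windows, so the
    -- runs need no coordination.
    followBoth : ∀ {P : Coloring n → Set} → (∀ p q → p ≤ m₁ → q ≤ m₂ → P (arc a p (g + q))) →
      ∀ {es p q C D} → Follow (coord a) m₁ es p C → Follow (coord (a + g)) m₂ es q D →
      P (arc a p (g + q)) × ∃ λ L →
        requests L ≡ es × ListAll (P ∘ proj₂) L × cost (arc a p (g + q)) L ≤ C + D
    followBoth P-arc (stop p≤) (stop q≤) = P-arc _ _ p≤ q≤ , [] , refl , [] , z≤n
    followBoth P-arc {p = p} {q} (step {e} {q = p'} {C} p≤ fp) (step {q = q'} {D} q≤ fq)
      with followBoth P-arc fp fq
    ... | Pd , L , reqs , PL , cost≤ =
      P-arc p q p≤ q≤ , (e , arc a p' (g + q')) ∷ L , cong (e ∷_) reqs , Pd ∷ PL , (begin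
        hit (arc a p (g + q)) e + dist (arc a p (g + q)) (arc a p' (g + q')) + cost (arc a p' (g + q')) L
          ≤⟨ +-mono-≤ (+-mono-≤
               (≤-trans (hit-arc a (b₁ p≤) (b₂ q≤) e) (+-monoʳ-≤ (bit (coord a e ≡ᵇ p)) (request-shift e q≤)))
               (≤-trans (dist-arc a (b₁ p≤) (b₁ (start≤ fp)) (b₂ q≤) (b₂ (start≤ fq)))
                        (≤-reflexive (cong (∣ p - p' ∣ +_) (∣m+n-m+o∣≡∣n-o∣ g q q')))))
               cost≤ ⟩
        h₁ + h₂ + (∣ p - p' ∣ + ∣ q - q' ∣) + (C + D)
          ≡⟨ move h₁ h₂ ∣ p - p' ∣ ∣ q - q' ∣ C D ⟩
        h₁ + (∣ p - p' ∣ + C) + (h₂ + (∣ q - q' ∣ + D)) ∎)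
      where
      open ≤-Reasoning
      h₁ h₂ : ℕ
      h₁ = bit (coord a e ≡ᵇ p)
      h₂ = bit (coord (a + g) e ≡ᵇ q)
      start≤ : ∀ {E : Set} {pos : E → ℕ} {m es p C} → Follow pos m es p C → p ≤ m
      start≤ (stop p≤m)   = p≤m
      start≤ (step p≤m _) = p≤m
      b₁ : ∀ {p} → p ≤ m₁ → p < n
      b₁ p≤ = ≤-<-trans p≤ m₁<n
      b₂ : ∀ {q} → q ≤ m₂ → g + q < n
      b₂ q≤ = ≤-<-trans (+-monoʳ-≤ g q≤) g+m₂<n
      move : ∀ a b c d e f → a + b + (c + d) + (e + f) ≡ a + (c + e) + (b + (d + f))
      move = solve-∀

-- Finding the windows

module _ (f U : ℕ → Bool) where

  -- U marks the positions that are recoloured during the phase.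
  record Transition (M : ℕ) : Set where
    field
      y m     : ℕ
      y∉U     : U y ≡ false
      y+1+m∉U : U (y + suc m) ≡ false
      flips   : f (y + suc m) ≡ not (f y)
      bound   : y + suc m < M
      m≤      : m ≤ cnt U M

  agree : Bool → ℕ → Bool
  agree z i = not (f i xor z)

  -- State of the scan before a transition is found: `y` is the last unmarked position, followed by
  -- `g` marked ones. The final inequality records that every position so far is marked or has
  -- colour `z`.
  Unicolor : Bool → ℕ → Set
  Unicolor z M = ∃₂ λ y g → M ≡ y + suc g × U y ≡ false × f y ≡ z ×
    g ≤ cnt U M × M ≤ cnt U M + cnt (agree z) M

  -- A transition appears at the first unmarked position whose colour differs from that of the
  -- previous unmarked one. The gap between the two is marked, which bounds its length by the count
  -- of `U`.
  scan : ∀ M → Transition M ⊎ M ≤ cnt U M ⊎ ∃ λ z → Unicolor z M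
  scan zero = inj₂ (inj₁ z≤n)
  scan (suc M) with scan M | U M in UM
  ... | inj₁ t | _ = inj₁ record
    { Transition t
    ; bound = m<n⇒m<1+n (Transition.bound t)
    ; m≤    = ≤-trans (Transition.m≤ t) (cnt-monoʳ U (n≤1+n M)) }
  ... | inj₂ (inj₁ le) | true  = inj₂ (inj₁ (≤-trans (+-mono-≤ {1} ≤-refl le)
    (≤-reflexive (sym (trans (cnt-snoc U M) (trans (cong (λ b → cnt U M + bit b) UM) (+-comm _ 1)))))))
  ... | inj₂ (inj₁ le) | false = inj₂ (inj₂ (f M , M , 0 , sym (+-comm M 1) , UM , refl , z≤n , (begin
    suc M                                          ≡⟨ +-comm 1 M ⟩
    M + 1                                          ≤⟨ +-mono-≤ le (m≤n+m 1 _) ⟩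
    cnt U M + (cnt (agree (f M)) M + 1)            ≡⟨ cong (λ b → cnt U M + (cnt (agree (f M)) M + bit (not b))) (xor-same (f M)) ⟨
    cnt U M + (cnt (agree (f M)) M + bit (agree (f M) M)) ≡⟨ cong (cnt U M +_) (cnt-snoc (agree (f M)) M) ⟨
    cnt U M + cnt (agree (f M)) (suc M)            ≤⟨ +-monoˡ-≤ _ (cnt-monoʳ U (n≤1+n M)) ⟩
    cnt U (suc M) + cnt (agree (f M)) (suc M)      ∎)))
    where open ≤-Reasoning
  ... | inj₂ (inj₂ (z , y , g , M≡ , y∉ , fy , g≤ , M≤)) | true = inj₂ (inj₂ (z , y , suc g ,
      trans (cong suc M≡) (sym (+-suc y (suc g))) , y∉ , fy ,
      ≤-trans (s≤s g≤) (≤-reflexive (sym cntU)) ,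
      ≤-trans (s≤s M≤) (+-mono-≤ (≤-reflexive (sym cntU)) (cnt-monoʳ (agree z) (n≤1+n M)))))
    where
    cntU : cnt U (suc M) ≡ suc (cnt U M)
    cntU = trans (cnt-snoc U M) (trans (cong (λ b → cnt U M + bit b) UM) (+-comm _ 1))
  ... | inj₂ (inj₂ (z , y , g , M≡ , y∉ , fy , g≤ , M≤)) | false with agree z M in fM
  ...   | true  = inj₂ (inj₂ (z , M , 0 , sym (+-comm M 1) , UM , agree⇒≡ (f M) z fM , z≤n , (begin
    suc M                                  ≤⟨ s≤s M≤ ⟩
    suc (cnt U M + cnt (agree z) M)        ≡⟨ +-suc (cnt U M) _ ⟨
    cnt U M + suc (cnt (agree z) M)        ≡⟨ cong (cnt U M +_) (+-comm 1 (cnt (agree z) M)) ⟩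
    cnt U M + (cnt (agree z) M + 1)        ≡⟨ cong (λ b → cnt U M + (cnt (agree z) M + bit b)) fM ⟨
    cnt U M + (cnt (agree z) M + bit (agree z M)) ≡⟨ cong (cnt U M +_) (cnt-snoc (agree z) M) ⟨
    cnt U M + cnt (agree z) (suc M)        ≤⟨ +-monoˡ-≤ _ (cnt-monoʳ U (n≤1+n M)) ⟩
    cnt U (suc M) + cnt (agree z) (suc M)  ∎)))
    where
    open ≤-Reasoning
    agree⇒≡ : ∀ a b → not (a xor b) ≡ true → a ≡ b
    agree⇒≡ false false _ = refl
    agree⇒≡ true  true  _ = refl
  ...   | false = inj₁ record
    { y = y ; m = g ; y∉U = y∉
    ; y+1+m∉U = trans (cong U (sym M≡)) UM
    ; flips   = trans (cong f (sym M≡)) (trans (disagree⇒≡not (f M) z fM) (cong not (sym fy)))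
    ; bound   = s≤s (≤-reflexive (sym M≡))
    ; m≤      = ≤-trans g≤ (cnt-monoʳ U (n≤1+n M)) }
    where
    disagree⇒≡not : ∀ a b → not (a xor b) ≡ false → a ≡ not b
    disagree⇒≡not false true  _ = refl
    disagree⇒≡not true  false _ = refl

  -- Pigeonhole: without a transition, at most `u` marked positions and at most `h` of a single
  -- colour would cover `h + u + 1` positions.
  transition : ∀ {h u} → cnt U (suc (h + u)) ≤ u → (∀ z → cnt (agree z) (suc (h + u)) ≤ h) →
               Transition (suc (h + u))
  transition {h} {u} U≤ agree≤ with scan (suc (h + u))
  ... | inj₁ t = t
  ... | inj₂ (inj₁ le) = ⊥-elim (<⇒≱ (s≤s (m≤n+m u h)) (≤-trans le U≤))
  ... | inj₂ (inj₂ (z , _ , _ , _ , _ , _ , _ , le)) =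
    ⊥-elim (<⇒≱ (s≤s (≤-reflexive (+-comm u h))) (≤-trans le (+-mono-≤ U≤ (agree≤ z))))

-- Balance of the two-cut colourings and simulation of one phase

InClassAt : ∀ {n} .{{_ : NonZero n}} → ℕ → Coloring n → Set
InClassAt k d = Balanced (3 * k + 2) (2 * k) d × cutCount d ≤ 2 * k

hit≤1 : ∀ {n} .{{_ : NonZero n}} (c : Coloring n) e → hit c e ≤ 1
hit≤1 c e = bit≤1 (cutAt c e)

dist≤n : ∀ {n} (c d : Coloring n) → dist c d ≤ n
dist≤n c d = count-≤ (λ v → c v xor d v)

⌈n/2⌉+⌈n/2⌉≤1+n : ∀ n → ⌈ n /2⌉ + ⌈ n /2⌉ ≤ suc n
⌈n/2⌉+⌈n/2⌉≤1+n n = ≤-trans (+-monoʳ-≤ ⌈ n /2⌉ (⌈n/2⌉-mono (n≤1+n n)))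
  (≤-reflexive (⌊n/2⌋+⌈n/2⌉≡n (suc n)))

n≤⌈n/2⌉+⌈n/2⌉ : ∀ n → n ≤ ⌈ n /2⌉ + ⌈ n /2⌉
n≤⌈n/2⌉+⌈n/2⌉ n = ≤-trans (≤-reflexive (sym (⌊n/2⌋+⌈n/2⌉≡n n))) (+-monoˡ-≤ ⌈ n /2⌉ (⌊n/2⌋≤⌈n/2⌉ n))

⌈n/2⌉+m≤n : ∀ {m n} → m + m ≤ n → ⌈ n /2⌉ + m ≤ n
⌈n/2⌉+m≤n {m} {n} 2m≤n = begin
  ⌈ n /2⌉ + m          ≡⟨ cong (⌈ n /2⌉ +_) (n≡⌊n+n/2⌋ m) ⟩
  ⌈ n /2⌉ + ⌊ m + m /2⌋ ≤⟨ +-monoʳ-≤ ⌈ n /2⌉ (⌊n/2⌋-mono 2m≤n) ⟩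
  ⌈ n /2⌉ + ⌊ n /2⌋     ≡⟨ +-comm ⌈ n /2⌉ _ ⟩
  ⌊ n /2⌋ + ⌈ n /2⌉     ≡⟨ ⌊n/2⌋+⌈n/2⌉≡n n ⟩
  n                     ∎
  where open ≤-Reasoning

m+m≤n⇒m<n : ∀ {m n} → 0 < n → m + m ≤ n → m < n
m+m≤n⇒m<n {zero}  0<n _    = 0<n
m+m≤n⇒m<n {suc m} _   2m≤n = ≤-trans (s≤s (m≤n+m (suc m) m)) 2m≤n

-- With `n = 2h` the balance bound is `3h/2 + h/k`. Here `k * u ≤ h` turns `u` into `h/k`, and the
-- strict inequality absorbs the rounding up of `s` from `h/2`.
long-side : ∀ k {h u s N} → k * u ≤ h → s + s ≤ suc h → N < s + h + u →
            2 * (2 * k) * N ≤ (3 * k + 2) * (h * 2)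
long-side k {h} {u} {s} {N} ku≤h 2s≤ N< = +-cancelʳ-≤ (4 * k) _ _ (begin
  2 * (2 * k) * N + 4 * k                       ≡⟨ e₁ k N ⟩
  4 * k * suc N                                 ≤⟨ *-monoʳ-≤ (4 * k) N< ⟩
  4 * k * (s + h + u)                           ≡⟨ e₂ k s h u ⟩
  2 * k * (s + s) + 4 * k * h + 4 * (k * u)     ≤⟨ +-mono-≤ (+-monoˡ-≤ (4 * k * h) (*-monoʳ-≤ (2 * k) 2s≤)) (*-monoʳ-≤ 4 ku≤h) ⟩
  2 * k * suc h + 4 * k * h + 4 * h             ≤⟨ m≤m+n _ (2 * k) ⟩
  2 * k * suc h + 4 * k * h + 4 * h + 2 * k     ≡⟨ e₃ k h ⟩
  (3 * k + 2) * (h * 2) + 4 * k                 ∎)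
  where
  open ≤-Reasoning
  e₁ : ∀ k N → 2 * (2 * k) * N + 4 * k ≡ 4 * k * suc N
  e₁ = solve-∀
  e₂ : ∀ k s h u → 4 * k * (s + h + u) ≡ 2 * k * (s + s) + 4 * k * h + 4 * (k * u)
  e₂ = solve-∀
  e₃ : ∀ k h → 2 * k * suc h + 4 * k * h + 4 * h + 2 * k ≡ (3 * k + 2) * (h * 2) + 4 * k
  e₃ = solve-∀

-- The other side has `2h - N ≤ 2h - s + u ≤ 3h/2 + h/k` nodes; rounding `s` up helps here.
short-side : ∀ k {h u s N M} → k * u ≤ h → h ≤ s + s → s ≤ N + u → N + M ≡ h * 2 →
             2 * (2 * k) * M ≤ (3 * k + 2) * (h * 2)
short-side k {h} {u} {s} {N} {M} ku≤h h≤2s s≤ N+M≡2h = +-cancelʳ-≤ (2 * k * h) _ _ (begin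
  2 * (2 * k) * M + 2 * k * h           ≤⟨ +-monoʳ-≤ (2 * (2 * k) * M) (*-monoʳ-≤ (2 * k) h≤2s) ⟩
  2 * (2 * k) * M + 2 * k * (s + s)     ≡⟨ e₁ k M s ⟩
  4 * k * (M + s)                       ≤⟨ *-monoʳ-≤ (4 * k) (+-monoʳ-≤ M s≤) ⟩
  4 * k * (M + (N + u))                 ≡⟨ e₂ k M N u ⟩
  4 * k * (N + M) + 4 * (k * u)         ≤⟨ +-mono-≤ (≤-reflexive (cong (4 * k *_) N+M≡2h)) (*-monoʳ-≤ 4 ku≤h) ⟩
  4 * k * (h * 2) + 4 * h               ≡⟨ e₃ k h ⟩
  (3 * k + 2) * (h * 2) + 2 * k * h     ∎)
  where
  open ≤-Reasoning
  e₁ : ∀ k M s → 2 * (2 * k) * M + 2 * k * (s + s) ≡ 4 * k * (M + s)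
  e₁ = solve-∀
  e₂ : ∀ k M N u → 4 * k * (M + (N + u)) ≡ 4 * k * (N + M) + 4 * (k * u)
  e₂ = solve-∀
  e₃ : ∀ k h → 4 * k * (h * 2) + 4 * h ≡ (3 * k + 2) * (h * 2) + 2 * k * h
  e₃ = solve-∀

module _ {n : ℕ} .{{_ : NonZero n}} where

  count-not : ∀ (c : Coloring n) → count c + count (not ∘ c) ≡ n
  count-not c = trans (cong₂ _+_ (count-from c 0) (count-from (not ∘ c) 0)) (cnt-not (λ i → c (i mod n)) n)

  cnt-window : ∀ (b : Fin n → Bool) x {M} → M ≤ n → cnt (λ i → b ((x + i) mod n)) M ≤ count b
  cnt-window b x M≤n = ≤-trans (cnt-monoʳ _ M≤n) (≤-reflexive (sym (count-from b x)))

  touched : Coloring n → Schedule n → Fin n → Bool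
  touched c []            v = false
  touched c ((e , d) ∷ L) v = (c v xor d v) ∨ touched d L v

  count-false : ∀ {m} → count {m} (λ _ → false) ≡ 0
  count-false {zero}  = refl
  count-false {suc m} = count-false {m}

  count-touched : ∀ c L → count (touched c L) ≤ cost c L
  count-touched c []            = ≤-reflexive (count-false {n})
  count-touched c ((e , d) ∷ L) = ≤-trans
    (count-subadditive {g = λ v → c v xor d v} {touched d L} (λ v → bit-∨ (c v xor d v) (touched d L v)))
    (+-mono-≤ (m≤n+m (dist c d) (hit c e)) (count-touched d L))

  untouched : ∀ c L v → touched c L v ≡ false → ListAll (λ x → proj₂ x v ≡ c v) L
  untouched c []            v _ = []
  untouched c ((e , d) ∷ L) v eq with c v in cv | d v in dv
  ... | true  | true  = dv ∷ ListAll.map (λ x → trans x dv) (untouched d L v eq)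
  ... | false | false = dv ∷ ListAll.map (λ x → trans x dv) (untouched d L v eq)

  -- `L` is a piece of the optimum of cost at most `u`. The bound `2u≤h` makes the windows fit on
  -- the ring and the phase cost at most `n`; `ku≤h` gives the balance.
  module Phase (k : ℕ) (1≤k : 1 ≤ k) (h u : ℕ) (n≡2h : n ≡ h * 2) (2u≤h : u + u ≤ h) (ku≤h : k * u ≤ h)
    (c : Coloring n) (red≤ : count c ≤ h) (blue≤ : count (not ∘ c) ≤ h)
    (L : Schedule n) (cost≤u : cost c L ≤ u) where

    n≡h+h : n ≡ h + h
    n≡h+h = trans n≡2h (trans (*-comm h 2) (cong (h +_) (+-identityʳ h)))

    u<h : u < h
    u<h = m+m≤n⇒m<n (n≢0⇒n>0 λ h≡0 → ≢-nonZero⁻¹ n (trans n≡2h (cong (_* 2) h≡0))) 2u≤h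

    record CutWindow (x : ℕ) : Set where
      field
        {y m p C} : ℕ
        bound     : y + suc m < suc (h + u)
        m≤u       : m ≤ u
        cut       : Follow (coord (x + y)) m (requests L) p C
        C≤        : C ≤ u + u

    -- The cost bounds the touched nodes by `u` and the balance of `c` bounds each colour by `h`, so
    -- `transition` finds two anchors among the `h + u + 1` nodes from `x`. Being untouched, they
    -- remain anchors throughout the phase.
    window : ∀ x → CutWindow x
    window x = record
      { bound = bound
      ; m≤u   = m≤u
      ; cut   = proj₁ (proj₂ (proj₂ followed))
      ; C≤    = ≤-trans (proj₂ (proj₂ (proj₂ followed))) (+-mono-≤ cost≤u m≤u)
      }
      where
      M≤n : suc (h + u) ≤ n
      M≤n = ≤-trans (≤-reflexive (sym (+-suc h u))) (≤-trans (+-monoʳ-≤ h u<h) (≤-reflexive (sym n≡h+h)))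
      f U : ℕ → Bool
      f i = c ((x + i) mod n)
      U i = touched c L ((x + i) mod n)
      U≤u : cnt U (suc (h + u)) ≤ u
      U≤u = ≤-trans (cnt-window (touched c L) x M≤n) (≤-trans (count-touched c L) cost≤u)
      agree≤ : ∀ z → cnt (agree f U z) (suc (h + u)) ≤ h
      agree≤ z = ≤-trans (cnt-window (λ v → not (c v xor z)) x M≤n) (lemma z)
        where
        lemma : ∀ z → count (λ v → not (c v xor z)) ≤ h
        lemma false = ≤-trans (≤-reflexive (count-cong (λ v → cong not (xor-identityʳ (c v))))) blue≤
        lemma true  = ≤-trans (≤-reflexive (count-cong (λ v → not-xor-true (c v)))) red≤
          where
          not-xor-true : ∀ b → not (b xor true) ≡ b
          not-xor-true false = refl
          not-xor-true true  = refl
      open Transition (transition f U U≤u agree≤)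
      m≤u : m ≤ u
      m≤u = ≤-trans m≤ U≤u
      color : Coloring n → ℕ → Bool
      -- The xor with `not (f y)` makes the first anchor read true whatever its colour; by
      -- `xor-cancelˡ` such a global swap affects neither hits nor distances.
      color d i = not (f y) xor d ((x + y + i) mod n)
      open Window color (coord (x + y)) m
        (λ d e _ → ≤-reflexive (cong bit (trans
          (xor-cancelˡ (not (f y)) (d ((x + y + coord (x + y) e) mod n)) _)
          (cong₂ _xor_ (cong d (+-coord (x + y) e)) (cong d (sym (next-coord (x + y) e)))))))
        (λ d d' → ≤-trans (≤-reflexive (cnt-cong m (λ i _ → trans
            (xor-cancelˡ (not (f y)) (d ((x + y + suc i) mod n)) _)
            (cong (λ j → d (j mod n) xor d' (j mod n)) (+-suc (x + y) i)))))
          (cnt-window (λ v → d v xor d' v) (suc (x + y))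
            (≤-trans (n≤1+n m) (≤-trans (m≤n+m (suc m) y) (≤-trans (<⇒≤ bound) M≤n)))))
      anchor : ∀ d → d ((x + y) mod n) ≡ f y → d ((x + (y + suc m)) mod n) ≡ f (y + suc m) → Anchored d
      anchor d eq₁ eq₂ =
        trans (cong (not (f y) xor_) (trans (cong (λ j → d (j mod n)) (+-identityʳ (x + y))) eq₁))
              (xor-inverseˡ (f y)) ,
        trans (cong (not (f y) xor_)
                (trans (cong (λ j → d (j mod n)) (+-assoc x y (suc m))) (trans eq₂ flips)))
              (xor-same (not (f y)))
      followed : ∃₂ λ p C → Follow (coord (x + y)) m (requests L) p C × C ≤ cost c L + m
      followed = follow c L (anchor c refl refl)
        (ListAll.zipWith (λ {r} (eq₁ , eq₂) → anchor (proj₂ r) eq₁ eq₂)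
          (untouched c L _ y∉U , untouched c L _ y+1+m∉U))

    -- A quarter of the ring, rounded up. The second search starts `s` past the first window, so the
    -- two cuts are at least `s - u` and less than `s + h + u` apart.
    s : ℕ
    s = ⌈ h /2⌉

    combine : (w₁ : CutWindow 0) → CutWindow (CutWindow.y w₁ + s) →
      ∃₂ λ d L' → requests L' ≡ requests L × InClassAt k d ×
      ListAll (InClassAt k ∘ proj₂) L' × cost d L' ≤ n
    combine record { y = a ; m = m₁ ; p = p ; C = C ; m≤u = m₁≤u ; cut = fol₁ ; C≤ = C≤ }
            record { y = y ; m = m₂ ; p = q ; C = D ; bound = y+m₂< ; cut = fol₂ ; C≤ = D≤ } =
      let Pd , L' , reqs , PL , cost≤ = followBoth a (s + y) m₁<n r<n {InClassAt k} inClass fol₁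
            (subst (λ o → Follow (coord o) m₂ (requests L) q D) (+-assoc a s y) fol₂)
      in arc a p (s + y + q) , L' , reqs , Pd , PL ,
         ≤-trans cost≤ (≤-trans (+-mono-≤ C≤ D≤)
           (≤-trans (+-mono-≤ 2u≤h 2u≤h) (≤-reflexive (sym n≡h+h))))
      where
      open ≤-Reasoning
      r<shu : s + y + m₂ < s + h + u
      r<shu = begin
        suc (s + y + m₂)   ≡⟨ cong suc (+-assoc s y m₂) ⟩
        suc (s + (y + m₂)) ≡⟨ +-suc s (y + m₂) ⟨
        s + suc (y + m₂)   ≡⟨ cong (s +_) (+-suc y m₂) ⟨
        s + (y + suc m₂)   ≤⟨ +-monoʳ-≤ s (s≤s⁻¹ y+m₂<) ⟩
        s + (h + u)        ≡⟨ +-assoc s h u ⟨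
        s + h + u          ∎
      shu≤n : s + h + u ≤ n
      shu≤n = begin
        s + h + u     ≡⟨ move s h u ⟩
        s + u + h     ≤⟨ +-monoˡ-≤ h (⌈n/2⌉+m≤n 2u≤h) ⟩
        h + h         ≡⟨ n≡h+h ⟨
        n             ∎
        where
        move : ∀ s h u → s + h + u ≡ s + u + h
        move = solve-∀
      r<n : s + y + m₂ < n
      r<n = ≤-trans r<shu shu≤n
      u<shu : u < s + h + u
      u<shu = ≤-trans u<h (≤-trans (m≤n+m h s) (m≤m+n (s + h) u))
      m₁<n : m₁ < n
      m₁<n = ≤-<-trans m₁≤u (≤-trans u<shu shu≤n)
      inClass : ∀ p q → p ≤ m₁ → q ≤ m₂ → InClassAt k (arc a p (s + y + q))
      inClass p q p≤ q≤ = (to-n (long-side k ku≤h (⌈n/2⌉+⌈n/2⌉≤1+n h) count<) ,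
           to-n (short-side k ku≤h (n≤⌈n/2⌉+⌈n/2⌉ h) s≤ (trans (count-not (arc a p r)) n≡2h))) ,
          ≤-trans (cutCount-arc a p<n r'<n) (*-monoʳ-≤ 2 1≤k)
        where
        r : ℕ
        r = s + y + q
        r≤ : r ≤ s + y + m₂
        r≤ = +-monoʳ-≤ (s + y) q≤
        p<n : p < n
        p<n = ≤-<-trans p≤ m₁<n
        r'<n : r < n
        r'<n = ≤-<-trans r≤ r<n
        count≡ : count (arc a p r) ≡ ∣ p - r ∣
        count≡ = count-arc a p<n r'<n
        count< : count (arc a p r) < s + h + u
        count< = ≤-<-trans (≤-trans (≤-reflexive count≡) (∣m-n∣≤m⊔n p r))
          (⊔-lub (≤-<-trans (≤-trans p≤ m₁≤u) u<shu) (≤-<-trans r≤ r<shu))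
        s≤ : s ≤ count (arc a p r) + u
        s≤ = begin
          s                        ≤⟨ ≤-trans (m≤m+n s y) (m≤m+n (s + y) q) ⟩
          r                        ≤⟨ m≤n+∣n-m∣ r p ⟩
          p + ∣ p - r ∣            ≤⟨ +-monoˡ-≤ _ (≤-trans p≤ m₁≤u) ⟩
          u + ∣ p - r ∣            ≡⟨ +-comm u _ ⟩
          ∣ p - r ∣ + u            ≡⟨ cong (_+ u) count≡ ⟨
          count (arc a p r) + u    ∎
        to-n : ∀ {x} → x ≤ (3 * k + 2) * (h * 2) → x ≤ (3 * k + 2) * n
        to-n = subst (λ n → _ ≤ (3 * k + 2) * n) (sym n≡2h)

    phase : ∃₂ λ d L' → requests L' ≡ requests L × InClassAt k d ×
            ListAll (InClassAt k ∘ proj₂) L' × cost d L' ≤ n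
    phase = combine (window 0) (window (CutWindow.y (window 0) + s))

-- Optimal schedules

allColorings : ∀ n → List (Coloring n)
allColorings zero    = (λ ()) ∷ []
allColorings (suc n) = map (false Vector.∷_) (allColorings n) ++ map (true Vector.∷_) (allColorings n)

-- Colourings are functions, so completeness is up to pointwise equality, which `Balanced-cong` and
-- `runCost-cong` carry through.
allColorings-complete : ∀ {n} (c : Coloring n) → Any (λ d → ∀ v → d v ≡ c v) (allColorings n)
allColorings-complete {zero}  c = here λ ()
allColorings-complete {suc n} c with c fzero in c₀
... | false = Any.++⁺ˡ (Any.map⁺ (Any.map
  (λ eq → λ { fzero → sym c₀ ; (fsuc v) → eq v }) (allColorings-complete (c ∘ fsuc))))
... | true  = Any.++⁺ʳ _ (Any.map⁺ (Any.map
  (λ eq → λ { fzero → sym c₀ ; (fsuc v) → eq v }) (allColorings-complete (c ∘ fsuc))))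

balanced? : ∀ {n} p q (c : Coloring n) → Dec (Balanced p q c)
balanced? {n} p q c =
  (2 * q * count c ≤? p * n) ×-dec (2 * q * count (λ v → not (c v)) ≤? p * n)

Balanced-cong : ∀ {n} {p q} {c d : Coloring n} → (∀ v → d v ≡ c v) → Balanced p q c → Balanced p q d
Balanced-cong {n} {p} {q} d≡c (r , b) =
  subst (λ x → 2 * q * x ≤ p * n) (sym (count-cong d≡c)) r ,
  subst (λ x → 2 * q * x ≤ p * n) (sym (count-cong (cong not ∘ d≡c))) b

module _ {n : ℕ} .{{_ : NonZero n}} where

  runCost-cong : ∀ {c d : Coloring n} → (∀ v → d v ≡ c v) → ∀ σ S → runCost d σ S ≡ runCost c σ S
  runCost-cong d≡c []      []      = refl
  runCost-cong d≡c (e ∷ σ) (s ∷ S) = cong (_+ runCost s σ S) (cong₂ _+_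
    (cong bit (cong₂ _xor_ (d≡c e) (d≡c (next e))))
    (count-cong (λ v → cong (_xor s v) (d≡c v))))

  Optimal : Coloring n → (σ : List (Fin n)) → Vec (Coloring n) (length σ) → Set
  Optimal c σ S = All (Balanced 1 1) S ×
    (∀ S' → All (Balanced 1 1) S' → runCost c σ S ≤ runCost c σ S')

  module _ (c₀ : Coloring n) (c₀-balanced : Balanced 1 1 c₀) where

    -- The simulation is fixed before the schedule it is compared with, so it must follow an actual
    -- optimum. Recursion on the requests finds one, minimising over the finitely many balanced next
    -- colourings.
    optimum : ∀ c σ → ∃ (Optimal c σ)
    optimum c []      = [] , [] , λ { [] _ → z≤n }
    optimum c (e ∷ σ) = s ∷ proj₁ (optimum s σ) , s-balanced ∷ proj₁ (proj₂ (optimum s σ)) , best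
      where
      value : Coloring n → ℕ
      value d = dist c d + runCost d σ (proj₁ (optimum d σ))
      candidates : List (Coloring n)
      candidates = filter (balanced? 1 1) (allColorings n)
      s : Coloring n
      -- The default value `c₀` is balanced as well, hence so is the minimiser.
      s = argmin value c₀ candidates
      s-balanced : Balanced 1 1 s
      s-balanced = argmin-all value c₀-balanced (ListAll.all-filter (balanced? 1 1) (allColorings n))
      best : ∀ S' → All (Balanced 1 1) S' →
             runCost c (e ∷ σ) (s ∷ proj₁ (optimum s σ)) ≤ runCost c (e ∷ σ) S'
      best (d ∷ S') (bd ∷ bS') with find (allColorings-complete d)
      ... | d' , d'∈ , d'≡d = ≤-trans (≤-reflexive (+-assoc (hit c e) _ _))
        (≤-trans (+-monoʳ-≤ (hit c e) (f[argmin]≤v⁺ c₀ candidates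
          (inj₂ (lose (∈-filter⁺ (balanced? 1 1) d'∈ (Balanced-cong {p = 1} {1} d'≡d bd)) (begin
            dist c d' + runCost d' σ (proj₁ (optimum d' σ))
              ≤⟨ +-monoʳ-≤ (dist c d') (proj₂ (proj₂ (optimum d' σ)) S' bS') ⟩
            dist c d' + runCost d' σ S'
              ≡⟨ cong₂ _+_ (count-cong (λ v → cong (c v xor_) (d'≡d v))) (runCost-cong d'≡d σ S') ⟩
            dist c d + runCost d σ S' ∎)))))
        (≤-reflexive (sym (+-assoc (hit c e) _ _))))
        where open ≤-Reasoning

  -- Division into phases and concatenation of their simulations

  toSchedule : (σ : List (Fin n)) → Vec (Coloring n) (length σ) → Schedule n
  toSchedule []      []      = []
  toSchedule (e ∷ σ) (s ∷ S) = (e , s) ∷ toSchedule σ S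

  requests-toSchedule : ∀ σ S → requests (toSchedule σ S) ≡ σ
  requests-toSchedule []      []      = refl
  requests-toSchedule (e ∷ σ) (s ∷ S) = cong (e ∷_) (requests-toSchedule σ S)

  cost-toSchedule : ∀ c σ S → cost c (toSchedule σ S) ≡ runCost c σ S
  cost-toSchedule c []      []      = refl
  cost-toSchedule c (e ∷ σ) (s ∷ S) = cong (hit c e + dist c s +_) (cost-toSchedule s σ S)

  All-toSchedule : ∀ {P : Coloring n → Set} σ {S} → All P S → ListAll (P ∘ proj₂) (toSchedule σ S)
  All-toSchedule []      []         = []
  All-toSchedule (e ∷ σ) (ps ∷ pS) = ps ∷ All-toSchedule σ pS

  fromSchedule : ∀ {P : Coloring n → Set} L {σ} → requests L ≡ σ → ListAll (P ∘ proj₂) L →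
    ∃ λ ds → All P ds × (∀ d → runCost d σ ds ≡ cost d L)
  fromSchedule []            refl []       = [] , [] , λ _ → refl
  fromSchedule ((e , s) ∷ L) refl (ps ∷ pL) with fromSchedule L refl pL
  ... | ds , pds , eq = s ∷ ds , ps ∷ pds , λ d → cong (hit d e + dist d s +_) (eq s)

  Split : ℕ → Coloring n → Schedule n → Set
  Split u c L = cost c L ≤ u ⊎
    ∃₂ λ L₁ x → ∃ λ L₂ → L ≡ L₁ ++ x ∷ L₂ × cost c L₁ ≤ u × u + cost (proj₂ x) L₂ < cost c L

  -- Greedy: `x` is the first step that overruns the budget and belongs to neither phase. Strictly
  -- more than `u` is spent on `L₁` and `x` together, which will pay for a restart.
  split : ∀ u c L → Split u c L
  split u c [] = inj₁ z≤n
  split u c ((e , d) ∷ L) with hit c e + dist c d ≤? u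
  ... | no  w≰u = inj₂ ([] , (e , d) , L , refl , z≤n , +-monoˡ-< (cost d L) (≰⇒> w≰u))
  ... | yes w≤u with split (u ∸ (hit c e + dist c d)) d L
  ...   | inj₁ le = inj₁ (≤-trans (+-monoʳ-≤ _ le) (≤-reflexive (m+[n∸m]≡n w≤u)))
  ...   | inj₂ (L₁ , x , L₂ , refl , le , lt) = inj₂ ((e , d) ∷ L₁ , x , L₂ , refl ,
      ≤-trans (+-monoʳ-≤ w le) (≤-reflexive (m+[n∸m]≡n w≤u)) ,
      ≤-<-trans (≤-reflexive (trans (cong (_+ cost (proj₂ x) L₂) (sym (m+[n∸m]≡n w≤u))) (+-assoc w (u ∸ w) _)))
        (+-monoʳ-< w lt))
    where
    w : ℕ
    w = hit c e + dist c d

  -- At the step between two phases the colouring is replaced outright: one for the hit and at most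
  -- `n` for the recolouring.
  cost-++-≤ : ∀ d (L₁ : Schedule n) e d' L₂ →
              cost d (L₁ ++ (e , d') ∷ L₂) ≤ cost d L₁ + (suc n + cost d' L₂)
  cost-++-≤ d []             e d' L₂ = +-monoˡ-≤ (cost d' L₂) (+-mono-≤ (hit≤1 d e) (dist≤n d d'))
  cost-++-≤ d ((e₁ , d₁) ∷ L₁) e d' L₂ = ≤-trans (+-monoʳ-≤ _ (cost-++-≤ d₁ L₁ e d' L₂))
    (≤-reflexive (sym (+-assoc (hit d e₁ + dist d d₁) (cost d₁ L₁) _)))

  module _ (k : ℕ) (1≤k : 1 ≤ k) (h u : ℕ) (n≡2h : n ≡ h * 2) (2u≤h : u + u ≤ h) (ku≤h : k * u ≤ h)
    (n≤4k[1+u] : n ≤ 4 * k * suc u) where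

    -- Source of the constant 12: a phase and the following restart cost
    -- `n + suc n ≤ 3 * n ≤ 12 * k * suc u`, while the optimum has paid at least `suc u`.
    phases-cost : ∀ {A B} → u + A < B → n + (suc n + (12 * k * A + n)) ≤ 12 * k * B + n
    phases-cost {A} {B} lt = begin
      n + (suc n + (12 * k * A + n))        ≤⟨ +-monoʳ-≤ n (+-monoˡ-≤ _ (+-monoˡ-≤ n (>-nonZero⁻¹ n))) ⟩
      n + (n + n + (12 * k * A + n))        ≡⟨ e₁ n (12 * k * A) ⟩
      3 * n + 12 * k * A + n                ≤⟨ +-monoˡ-≤ n (+-monoˡ-≤ (12 * k * A) (*-monoʳ-≤ 3 n≤4k[1+u])) ⟩
      3 * (4 * k * suc u) + 12 * k * A + n  ≡⟨ e₂ k u A n ⟩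
      12 * k * suc (u + A) + n              ≤⟨ +-monoˡ-≤ n (*-monoʳ-≤ (12 * k) lt) ⟩
      12 * k * B + n                        ∎
      where
      open ≤-Reasoning
      e₁ : ∀ n X → n + (n + n + (X + n)) ≡ 3 * n + X + n
      e₁ = solve-∀
      e₂ : ∀ k u A n → 3 * (4 * k * suc u) + 12 * k * A + n ≡ 12 * k * suc (u + A) + n
      e₂ = solve-∀

    color≤h : ∀ {x} → 2 * 1 * x ≤ 1 * n → x ≤ h
    color≤h {x} le = *-cancelˡ-≤ 2 (≤-trans le (≤-reflexive
      (trans (*-identityˡ n) (trans n≡2h (*-comm h 2)))))

    Simulation : Schedule n → ℕ → Set
    Simulation L B = ∃₂ λ d L' → requests L' ≡ requests L × InClassAt k d ×
      ListAll (InClassAt k ∘ proj₂) L' × cost d L' ≤ B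

    Simulation-mono : ∀ {L B B'} → B ≤ B' → Simulation L B → Simulation L B'
    Simulation-mono B≤B' (d , L' , reqs , cd , cL' , le) = d , L' , reqs , cd , cL' , ≤-trans le B≤B'

    phase : ∀ c L → Balanced 1 1 c → cost c L ≤ u → Simulation L n
    phase c L (red , blue) = Phase.phase k 1≤k h u n≡2h 2u≤h ku≤h c (color≤h red) (color≤h blue) L

    concatenate : ∀ L₁ e s L₂ {B} → u + cost s L₂ < B → Simulation L₁ n →
      Simulation L₂ (12 * k * cost s L₂ + n) → Simulation (L₁ ++ (e , s) ∷ L₂) (12 * k * B + n)
    concatenate L₁ e s L₂ lt (d , L₁' , reqs₁ , cd , cL₁' , cost₁) (d' , L₂' , reqs₂ , cd' , cL₂' , cost₂) =
      d , L₁' ++ (e , d') ∷ L₂' ,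
      trans (map-++ proj₁ L₁' _) (trans (cong₂ (λ X Y → X ++ e ∷ Y) reqs₁ reqs₂) (sym (map-++ proj₁ L₁ _))) ,
      cd , ListAll.++⁺ cL₁' (cd' ∷ cL₂') ,
      ≤-trans (cost-++-≤ d L₁' e d' L₂') (≤-trans (+-mono-≤ cost₁ (+-monoʳ-≤ (suc n) cost₂)) (phases-cost lt))

    -- `l` bounds the length of `L` and makes the recursion on `L₂` structural. The additive `n` is
    -- the last phase, which no overrun pays for.
    simulate : ∀ l c L → length L ≤ l → Balanced 1 1 c → ListAll (Balanced 1 1 ∘ proj₂) L →
               Simulation L (12 * k * cost c L + n)
    simulate l c L len bc bL = continue l len (split u c L)
      where
      continue : ∀ l → length L ≤ l → Split u c L → Simulation L (12 * k * cost c L + n)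
      continue l _ (inj₁ le) = Simulation-mono (m≤n+m n _) (phase c L bc le)
      continue l len (inj₂ (L₁ , (e , s) , L₂ , refl , le , lt)) = next-phase l
        (≤-trans (≤-reflexive (sym (trans (length-++ L₁) (+-suc (length L₁) (length L₂))))) len)
        (ListAll.++⁻ʳ L₁ bL)
        where
        next-phase : ∀ l → length L₁ + length L₂ < l → ListAll (Balanced 1 1 ∘ proj₂) ((e , s) ∷ L₂) →
                     Simulation (L₁ ++ (e , s) ∷ L₂) (12 * k * cost c L + n)
        next-phase (suc l) len (bs ∷ bL₂) = concatenate L₁ e s L₂ lt (phase c L₁ bc le)
          (simulate l s L₂ (≤-trans (m≤n+m _ (length L₁)) (s≤s⁻¹ len)) bs bL₂)

-- The budget of a phase and the final bound

module _ (k h : ℕ) .{{_ : NonZero k}} where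

  private instance
    2k≢0 : NonZero (2 * k)
    2k≢0 = m*n≢0 2 k

  -- The factor 2 in the divisor `2 * k` secures `u + u ≤ h` even for `k = 1`, and rounding down
  -- still leaves `k * suc u` of order `n`.
  budget : ∃ λ u → u + u ≤ h × k * u ≤ h × h * 2 ≤ 4 * k * suc u
  budget = u , 2u≤h , ku≤h , 2h≤4k[1+u]
    where
    u : ℕ
    u = h / (2 * k)

    2ku≤h : u * (2 * k) ≤ h
    2ku≤h = m/n*n≤m h (2 * k)

    2u≤h : u + u ≤ h
    2u≤h = ≤-trans (≤-reflexive (lemma u)) (≤-trans (*-monoʳ-≤ u (*-monoʳ-≤ 2 (>-nonZero⁻¹ k))) 2ku≤h)
      where
      lemma : ∀ u → u + u ≡ u * 2
      lemma = solve-∀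

    ku≤h : k * u ≤ h
    ku≤h = ≤-trans (≤-reflexive (*-comm k u)) (≤-trans (*-monoʳ-≤ u (m≤m+n k _)) 2ku≤h)

    2h≤4k[1+u] : h * 2 ≤ 4 * k * suc u
    2h≤4k[1+u] = begin
      h * 2                             ≡⟨ cong (_* 2) (m≡m%n+[m/n]*n h (2 * k)) ⟩
      (h % (2 * k) + u * (2 * k)) * 2   ≤⟨ *-monoˡ-≤ 2 (+-monoˡ-≤ (u * (2 * k)) (m%n≤n h (2 * k))) ⟩
      (2 * k + u * (2 * k)) * 2         ≡⟨ lemma k u ⟩
      4 * k * suc u                     ∎
      where
      open ≤-Reasoning
      lemma : ∀ k u → (2 * k + u * (2 * k)) * 2 ≡ 4 * k * suc u
      lemma = solve-∀

theorem2 : Σ ℕ λ C₁ → Σ ℕ λ C₂ →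
    (k : ℕ) → 1 ≤ k →
    (n : ℕ) .{{_ : NonZero n}} → 2 ∣ n →
    (R : Coloring n → Coloring n) → RebalancingProcedure k R →
    (c₀ : Coloring n) → Balanced 1 1 c₀ →
    (σ : List (Fin n)) →
    Σ (Vec (Coloring n) (length σ)) λ ds →
    InClass k ds ×
    ((S : Vec (Coloring n) (length σ)) → All (Balanced 1 1) S →
    offCost R c₀ σ ds ≤ C₁ * k * runCost c₀ σ S + C₂ * n)
theorem2 = 12 , 4 , schedule
  where
  schedule : (k : ℕ) → 1 ≤ k →
    (n : ℕ) .{{_ : NonZero n}} → 2 ∣ n →
    (R : Coloring n → Coloring n) → RebalancingProcedure k R →
    (c₀ : Coloring n) → Balanced 1 1 c₀ →
    (σ : List (Fin n)) →
    Σ (Vec (Coloring n) (length σ)) λ ds →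
    InClass k ds ×
    ((S : Vec (Coloring n) (length σ)) → All (Balanced 1 1) S →
    offCost R c₀ σ ds ≤ 12 * k * runCost c₀ σ S + 4 * n)
  schedule k 1≤k n _ R _ c₀ _ [] = [] , [] , λ S _ →
    ≤-trans (≤-reflexive (+-identityʳ _)) (≤-trans (dist≤n c₀ (R c₀))
      (≤-trans (m≤m+n n (3 * n)) (m≤n+m (4 * n) (12 * k * runCost c₀ [] S))))
  -- The start `R c₀` is prescribed, so the simulation begins after the first request, following the
  -- optimum from its colouring `s`. The additive `4 * n` consists of the rebalancing, the first
  -- hit, the jump to `d` and the last phase.
  schedule k@(suc _) 1≤k n (divides h n≡2h) R _ c₀ bal (e ∷ σ) with optimum c₀ bal c₀ (e ∷ σ) | budget k h
  ... | s ∷ S , bs ∷ bS , opt | u , 2u≤h , ku≤h , 2h≤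
    with simulate k 1≤k h u n≡2h 2u≤h ku≤h (≤-trans (≤-reflexive n≡2h) 2h≤)
           _ s (toSchedule σ S) ≤-refl bs (All-toSchedule σ bS)
  ... | d , L , reqs , cd , cL , cost≤
    with fromSchedule {P = InClassAt k} L (trans reqs (requests-toSchedule σ S)) cL
  ... | ds , cds , run≡ = d ∷ ds , cd ∷ cds , λ S' bS' → begin
    dist c₀ (R c₀) + (hit (R c₀) e + dist (R c₀) d + runCost d σ ds)
      ≤⟨ +-mono-≤ (dist≤n c₀ (R c₀)) (+-mono-≤ (+-mono-≤
           (≤-trans (hit≤1 (R c₀) e) (>-nonZero⁻¹ n)) (dist≤n (R c₀) d))
           (≤-trans (≤-reflexive (run≡ d)) cost≤)) ⟩
    n + (n + n + (12 * k * cost s (toSchedule σ S) + n))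
      ≡⟨ move n (12 * k * cost s (toSchedule σ S)) ⟩
    12 * k * cost s (toSchedule σ S) + 4 * n
      ≤⟨ +-monoˡ-≤ (4 * n) (*-monoʳ-≤ (12 * k) (≤-trans (≤-reflexive (cost-toSchedule s σ S))
           (≤-trans (m≤n+m _ (hit c₀ e + dist c₀ s)) (opt S' bS')))) ⟩
    12 * k * runCost c₀ (e ∷ σ) S' + 4 * n ∎
    where
    open ≤-Reasoning
    move : ∀ n X → n + (n + n + (X + n)) ≡ X + 4 * n
    move = solve-∀
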